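{- Let $G$ be a Barnette graph (a $3$-connected cubic planar bipartite graph, embedded in the plane) whose faces are properly $3$-colored with color set $\{1,2,3\}$, and suppose the outer face of $G$ is a $3$-face. The following statements are equivalent: (i) $G$ has a hamiltonian cycle $C$ such that all $2$-faces lie inside $C$, all $3$-faces lie outside $C$, and $1$-faces may lie on either side; (ii) the reduced graph $H$ obtained from $G$ by contracting the $1$-faces has an $A$-trail; (iii) the reduced graph $H'$ obtained from $G$ by contracting the $2$-faces has a spanning tree of $1$-faces; (iv) the reduced graph $H''$ obtained from $G$ by contracting the $3$-faces has a spanning tree of $1$-faces.
   Context: A proper $3$-face-coloring assigns colors to faces so that faces sharing an edge get different colors; faces of color $i$ are called $i$-faces. In a cubic plane graph with such a coloring, each color class of faces is a facial $2$-factor (its boundary cycles are pairwise vertex-disjoint and cover all vertices). "Contracting the $i$-faces" means contracting the boundary cycle of each $i$-face to a single vertex, yielding a plane multigraph whose faces correspond to the faces of $G$ of the other two colors (and inherit their colors). For a $2$-connected eulerian plane graph $H$, an $A$-trail is a closed eulerian trail of $H$ in which any two consecutive edges belong to the boundary of a common face. For a $2$-connected plane multigraph $H$ with face set $\mathcal{F}(H)$, the radial graph $\mathcal{R}(H)$ is the bipartite graph on $V(H)\cup\mathcal{F}(H)$ where $x$ is adjacent to $F$ iff $x$ lies on the boundary of $F$; for $U\subseteq V(H)$, $\mathcal{T}\subseteq\mathcal{F}(H)$, $\mathcal{R}(U,\mathcal{T})$ is the subgraph induced by $U\cup\mathcal{T}$. Let $\mathcal{T}$ be a set of bounded faces with pairwise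 edge-disjoint boundaries covering every vertex of $H$, and $H_{\mathcal{T}}$ the subgraph formed by the edges of their boundaries; if $\mathcal{R}(V(H),\mathcal{T})$ is a tree, $H_{\mathcal{T}}$ is a spanning tree of faces. A spanning tree of $1$-faces is a spanning tree of faces $H_{\mathcal{T}}$ in which every face of $\mathcal{T}$ corresponds to a $1$-face of $G$. -}

module Defs where

open import Data.Nat using (ℕ; zero; suc; _+_; _≤_; _≤?_)
open import Data.Nat.DivMod using (_%_; m%n<n)
open import Data.Fin using (Fin; toℕ; fromℕ<)
open import Data.Fin.Properties using (all?)
open import Data.List using (length; filter)
open import Data.List.Base using (allFin)
open import Data.Bool using (Bool; true; false)
open import Data.Product using (Σ; ∃; ∃-syntax; _×_; _,_)
open import Data.Sum using (_⊎_; inj₁; inj₂)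
open import Data.Empty using (⊥)
open import Data.Unit using (⊤)
open import Relation.Nullary using (¬_)
open import Relation.Unary using (Decidable)
open import Relation.Binary.PropositionalEquality using (_≡_; _≢_)
open import Function.Bundles using (_⇔_)

iter : {A : Set} → (A → A) → ℕ → A → A
iter f zero x = x
iter f (suc k) x = f (iter f k x)

Orbit : {A : Set} → (A → A) → A → A → Set
Orbit f x y = ∃[ k ] iter f k x ≡ y

next : {m : ℕ} → Fin (suc m) → Fin (suc m)
next {m} j = fromℕ< (m%n<n (suc (toℕ j)) (suc m))

b2n : Bool → ℕ
b2n true = 1
b2n false = 0

data Color : Set where
  c1 c2 c3 : Color

-- Trees in a graph whose vertices are given by representatives
-- (Valid = is a vertex, Same = represent the same vertex, Adj = adjacency)

module _ {N : Set} (Valid : N → Set) (Same : N → N → Set) (Adj : N → N → Set) where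

  data Path : N → N → Set where
    here : ∀ {a b} → Same a b → Path a b
    step : ∀ {a b} c → Adj a c → Valid c → Path c b → Path a b

  GConnected : Set
  GConnected = ∀ a b → Valid a → Valid b → Path a b

  GCycle : Set
  GCycle = ∃[ k ] Σ (Fin (3 + k) → N) λ w →
             (∀ j → Valid (w j))
           × (∀ j j' → j ≢ j' → ¬ Same (w j) (w j'))
           × (∀ j → Adj (w j) (w (next j)))

  IsTree : Set
  IsTree = GConnected × ¬ GCycle

-- Combinatorial maps (rotation systems).  Darts are Fin n; α pairs the two
-- darts of an edge; σ is the rotation around a vertex (vertices = σ-orbits);
-- faces are the orbits of φ = σ ∘ α.  The darts d and α d lie on the two
-- faces on either side of the edge {d , α d}.

record Map : Set where
  field
    n : ℕ
    α : Fin n → Fin n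
    σ : Fin n → Fin n

module _ (G : Map) where
  open Map G

  φ : Fin n → Fin n
  φ d = σ (α d)

  SameV : Fin n → Fin n → Set
  SameV = Orbit σ

  SameF : Fin n → Fin n → Set
  SameF = Orbit φ

  -- d is the least dart of its f-orbit (f a permutation of Fin n)
  OrbitMin : (Fin n → Fin n) → Fin n → Set
  OrbitMin f d = (k : Fin n) → toℕ d ≤ toℕ (iter f (toℕ k) d)

  orbitMin? : (f : Fin n → Fin n) → Decidable (OrbitMin f)
  orbitMin? f d = all? (λ k → toℕ d ≤? toℕ (iter f (toℕ k) d))

  numOrbits : (Fin n → Fin n) → ℕ
  numOrbits f = length (filter (orbitMin? f) (allFin n))

  data Reach (E : Fin n → Set) (P : Fin n → Set) : Fin n → Fin n → Set where
    here : ∀ {u v} → SameV u v → Reach E P u v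
    step : ∀ {u v} w → SameV u w → E w → P (α w) → Reach E P (α w) v → Reach E P u v

  ConnectedOn : (Fin n → Set) → Set
  ConnectedOn P = ∀ u v → P u → P v → Reach (λ _ → ⊤) P u v

  IsInvolution : Set
  IsInvolution = (∀ d → α (α d) ≡ d) × (∀ d → α d ≢ d)

  Cubic : Set
  Cubic = ∀ d → iter σ 3 d ≡ d × σ d ≢ d

  Simple : Set
  Simple = (∀ d → ¬ SameV d (α d))
         × (∀ d e → SameV d e → SameV (α d) (α e) → d ≡ e)

  -- connected and of genus 0 (Euler's formula V - E + F = 2)
  Planar : Set
  Planar = ConnectedOn (λ _ → ⊤)
         × numOrbits σ + numOrbits φ ≡ numOrbits α + 2

  ThreeConnected : Set
  ThreeConnected = 4 ≤ numOrbits σ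
                 × ConnectedOn (λ _ → ⊤)
                 × (∀ x y → ConnectedOn (λ d → ¬ SameV d x × ¬ SameV d y))

  Bipartite : Set
  Bipartite = Σ (Fin n → Bool) λ b → (∀ d → b (σ d) ≡ b d) × (∀ d → b (α d) ≢ b d)

  Barnette : Set
  Barnette = IsInvolution × Cubic × Simple × Planar × ThreeConnected × Bipartite

  FaceColoring : (Fin n → Color) → Set
  FaceColoring c = (∀ d → c (φ d) ≡ c d) × (∀ d → c (α d) ≢ c d)

  HamCycle : (Fin n → Bool) → Set
  HamCycle inC = (∀ d → inC (α d) ≡ inC d)
               × (∀ d → b2n (inC d) + b2n (inC (σ d)) + b2n (inC (σ (σ d))) ≡ 2)
               × (∀ u v → Reach (λ w → inC w ≡ true) (λ _ → ⊤) u v)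

  -- s assigns each face a side (true = inside); crossing an edge changes the
  -- side iff the edge is on C; the outer face (of dart o) is outside
  Sides : (Fin n → Bool) → Fin n → (Fin n → Bool) → Set
  Sides inC o s = (∀ d → s (φ d) ≡ s d)
                × (∀ d → (s (α d) ≡ s d) ⇔ (inC d ≡ false))
                × s o ≡ false

  HamCycle2In3Out : (Fin n → Color) → Fin n → Set
  HamCycle2In3Out c o = ∃[ inC ] HamCycle inC × (∃[ s ] Sides inC o s
                          × (∀ d → c d ≡ c2 → s d ≡ true)
                          × (∀ d → c d ≡ c3 → s d ≡ false))

  -- The reduced graph obtained by contracting the i-faces, described on G:
  --   vertices : i-faces of G (darts X with c X ≡ i, up to SameF)
  --   edges    : edges {d , α d} of G with neither side an i-face; the dart d
  --              goes from the i-face at the G-vertex of d to the i-face at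
  --              the G-vertex of α d
  --   faces    : faces of G not of colour i

  module _ (c : Fin n → Color) (i : Color) where

    AtV : Fin n → Fin n → Set
    AtV x X = ∃[ e ] SameV x e × SameF e X

    SameHV : Fin n → Fin n → Set
    SameHV x y = ∃[ X ] c X ≡ i × AtV x X × AtV y X

    HDart : Fin n → Set
    HDart d = c d ≢ i × c (α d) ≢ i

    HFace : Fin n → Set
    HFace f = c f ≢ i

    EdgeOnFace : Fin n → Fin n → Set
    EdgeOnFace d f = SameF d f ⊎ SameF (α d) f

    VertexOnFace : Fin n → Fin n → Set
    VertexOnFace X f = ∃[ d ] SameF d f × AtV d X

    HasATrail : Set
    HasATrail = ∃[ k ] Σ (Fin (suc k) → Fin n) λ t →
                  (∀ j → HDart (t j))
                × (∀ j → SameHV (α (t j)) (t (next j)))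
                × (∀ d → HDart d → ∃[ j ] (t j ≡ d ⊎ t j ≡ α d))
                × (∀ j j' → (t j ≡ t j' ⊎ t j ≡ α (t j')) → j ≡ j')
                × (∀ j → ∃[ f ] HFace f × EdgeOnFace (t j) f × EdgeOnFace (t (next j)) f)

    -- radial graph R(V(H), T) with T given by the face predicate inT
    RValid : (Fin n → Bool) → Fin n ⊎ Fin n → Set
    RValid inT (inj₁ X) = c X ≡ i
    RValid inT (inj₂ f) = inT f ≡ true

    RSame : Fin n ⊎ Fin n → Fin n ⊎ Fin n → Set
    RSame (inj₁ x) (inj₁ y) = SameF x y
    RSame (inj₂ f) (inj₂ g) = SameF f g
    RSame _ _ = ⊥

    RAdj : Fin n ⊎ Fin n → Fin n ⊎ Fin n → Set
    RAdj (inj₁ X) (inj₂ f) = VertexOnFace X f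
    RAdj (inj₂ f) (inj₁ X) = VertexOnFace X f
    RAdj _ _ = ⊥

    -- spanning tree of 1-faces (o is a dart of the outer face)
    SpanningTreeOf1Faces : Fin n → (Fin n → Bool) → Set
    SpanningTreeOf1Faces o inT =
        (∀ d → inT (φ d) ≡ inT d)
      × (∀ d → inT d ≡ true → HFace d × ¬ SameF d o × c d ≡ c1)
      × (∀ d → HDart d → inT d ≡ true → inT (α d) ≡ true → SameF d (α d))
      × (∀ X → c X ≡ i → ∃[ f ] inT f ≡ true × VertexOnFace X f)
      × IsTree (RValid inT) RSame RAdj

    HasSpanningTreeOf1Faces : Fin n → Set
    HasSpanningTreeOf1Faces o = ∃[ inT ] SpanningTreeOf1Faces o inT

{-# OPTIONS --safe #-}

-- All four statements are shown equivalent to the existence of a "separation": a choice of a side for every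
-- 1-face such that, with the 2-faces inside and the 3-faces outside, the edges between the two sides form
-- a connected subgraph C (it automatically has degree 2 at every vertex, so it is a hamiltonian cycle).
-- Planarity enters only through a Jordan curve theorem, which follows from Euler's formula by the tree-cotree
-- decomposition: every closed walk of faces crosses exactly the edges of some vertex cut.  It shows that the
-- inside faces cannot contain a cycle of faces (the cut would miss C), and, with 3-connectedness, that two
-- faces share at most one edge.  Conversely, if the inside faces form a tree, a vertex cut missing C would
-- give an even set of edges between inside faces, hence a cycle unless it is empty.
-- An A-trail runs along C: at each 1-face all its transitions follow the adjacent 2-faces or all follow the
-- adjacent 3-faces, which decides the side of the 1-face.
module Submission where

open import Defs
open import Algebra.Bundles using (CommutativeMonoid; module CommutativeRing)
import Algebra.Properties.CommutativeMonoid.Sum as SumProperties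
open import Data.Bool using (Bool; true; false; not; _∧_; _∨_; _xor_; if_then_else_)
  renaming (_≟_ to _≟ᵇ_)
open import Data.Bool.Properties using (xor-∧-commutativeRing; xor-same; xor-comm; xor-identityʳ;
  xor-annihilates-not; ∧-distribˡ-xor; ∧-comm; ∧-zeroʳ; ∧-identityʳ; ∨-zeroʳ; ∧-conicalˡ; ∧-conicalʳ;
  not-injective; not-involutive; ¬-not)
open import Data.Empty using (⊥; ⊥-elim)
open import Data.Fin using (Fin; zero; suc; toℕ; fromℕ; fromℕ<; inject₁; _≟_)
open import Data.Fin.Induction using (<-weakInduction)
open import Data.Fin.Permutation using (permutation)
open import Data.Fin.Properties using (any?; pigeonhole; toℕ-injective; toℕ<n; toℕ-fromℕ; toℕ-fromℕ<; toℕ-inject₁)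
open import Data.Fin.Relation.Unary.Top using (view; ‵fromℕ; ‵inject₁)
open import Data.List using (List; []; _∷_; length; filter; tabulate; allFin; cartesianProduct)
open import Data.List.Membership.Propositional using (_∈_)
open import Data.List.Membership.Propositional.Properties using
  (∈-filter⁺; ∈-filter⁻; ∈-allFin; ∈-cartesianProduct⁺)
open import Data.List.Relation.Unary.Any using (here; there)
open import Data.Nat using (ℕ; zero; suc; _+_; _*_; _∸_; _≤_; _<_; z≤n; s≤s; _≤?_)
open import Data.Nat.DivMod using (_%_; _/_; m≡m%n+[m/n]*n; m%n<n; n%n≡0; m<n⇒m%n≡m)
import Data.Nat.Properties as ℕ
open import Data.Product using (Σ; ∃; ∃-syntax; _×_; _,_; proj₁; proj₂)
open import Data.Sum using (_⊎_; inj₁; inj₂; [_,_]′)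
open import Data.Unit using (⊤; tt)
open import Function using (_∘_; id)
open import Function.Bundles using (_⇔_; mk⇔; module Equivalence)
open import Level using (0ℓ)
open import Relation.Binary using (Rel; IsEquivalence; DecidableEquality; tri<; tri≈; tri>)
import Relation.Binary.Construct.Closure.Equivalence as EqClosure
open import Relation.Binary.Construct.Closure.Equivalence using (EqClosure)
open import Relation.Binary.Construct.Closure.ReflexiveTransitive using (ε; _◅_; return)
open import Relation.Binary.Construct.Closure.Symmetric using (fwd; bwd)
open import Relation.Binary.PropositionalEquality
  using (_≡_; _≢_; refl; sym; trans; cong; cong₂; subst; subst₂)
open import Relation.Nullary using (¬_; Dec; yes; no; does; contradiction)
open import Relation.Nullary.Decidable using (¬?; _×-dec_; _⊎-dec_; does-⇔; dec-true; dec-false)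
open import Relation.Unary using (Decidable)

-- Connectedness is expressed by two-colourings: every bit function that is constant across the
-- allowed moves is constant. This is the form in which the Jordan curve theorem delivers its cuts,
-- so a cut missing C contradicts connectedness at once. Actual paths are recovered only where a
-- definition asks for them, from the partition generated by a spanning forest. Euler's formula
-- merely counts orbits. It becomes topology through independence mod 2: bits on the edges of a
-- spanning tree can be prescribed freely by a vertex cut, and bits on the cotree by the boundary of
-- a face set. Edge sets are therefore `α`-invariant bit functions on darts, and parity arguments
-- are sums over darts. The reduced graphs are handled inside G. In a cubic map two different faces
-- meeting at a vertex share an edge, so incidence of a reduced vertex with a face turns into
-- adjacency of faces of G. Statements (iii) and (iv) are mirror images: the tree argument is
-- carried out for a generic pair of colours, and complementing the sides exchanges the two.

module PointSum (M : CommutativeMonoid 0ℓ 0ℓ) where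
  open CommutativeMonoid M using (Carrier; _≈_; ∙-cong; ∙-congˡ; identityˡ; identityʳ)
    renaming (ε to 0#; trans to ≈-trans)
  open SumProperties M using (sum; sum-cong-≋; sum-replicate-zero)

  sum-zero : ∀ {n} (h : Fin n → Carrier) → (∀ x → h x ≈ 0#) → sum h ≈ 0#
  sum-zero {n} h h≈0 = ≈-trans (sum-cong-≋ h≈0) (sum-replicate-zero n)

  sum-point : ∀ {n} (e : Fin n) (h : Fin n → Carrier) →
              (∀ x → x ≢ e → h x ≈ 0#) → sum h ≈ h e
  sum-point zero    h h≈0 =
    ≈-trans (∙-congˡ (sum-zero (h ∘ suc) λ x → h≈0 (suc x) λ ())) (identityʳ _)
  sum-point (suc e) h h≈0 =
    ≈-trans (∙-cong (h≈0 zero λ ()) (sum-point e (h ∘ suc) λ x x≢e → h≈0 (suc x) λ { refl → x≢e refl }))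
            (identityˡ _)

xor-commutativeMonoid : CommutativeMonoid 0ℓ 0ℓ
xor-commutativeMonoid = CommutativeRing.+-commutativeMonoid xor-∧-commutativeRing

open SumProperties xor-commutativeMonoid using () renaming
  (sum to ⨁; sum-cong-≗ to ⨁-cong; ∑-distrib-+ to ⨁-distrib-xor; ∑-comm to ⨁-comm; sum-permute to ⨁-permute)
open PointSum xor-commutativeMonoid using () renaming (sum-zero to ⨁-zero; sum-point to ⨁-point)
open SumProperties ℕ.+-0-commutativeMonoid using () renaming
  (sum to ∑; sum-cong-≗ to ∑-cong; ∑-distrib-+ to ∑-distrib-+)
open PointSum ℕ.+-0-commutativeMonoid using () renaming (sum-point to ∑-point)

⨁-reindex : ∀ {n} (f f⁻ : Fin n → Fin n) → (∀ x → f (f⁻ x) ≡ x) → (∀ x → f⁻ (f x) ≡ x) →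
            (h : Fin n → Bool) → ⨁ (h ∘ f) ≡ ⨁ h
⨁-reindex f f⁻ ff⁻ f⁻f h = sym (⨁-permute h (permutation f f⁻ ff⁻ f⁻f))

xor-≡ : ∀ {a b} → a xor b ≡ false → a ≡ b
xor-≡ {true}  {true}  _ = refl
xor-≡ {false} {false} _ = refl

xor-false : ∀ {a b} → a ≡ b → a xor b ≡ false
xor-false {a} refl = xor-same a

does-true : ∀ {A : Set} (d : Dec A) → does d ≡ true → A
does-true (yes a) _ = a

length-filter-tabulate : ∀ {A : Set} {P : A → Set} (P? : Decidable P) {n} (f : Fin n → A) →
  length (filter P? (tabulate f)) ≡ ∑ (λ x → b2n (does (P? (f x))))
length-filter-tabulate P? {zero}  f = refl
length-filter-tabulate P? {suc n} f with does (P? (f zero))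
... | true  = cong suc (length-filter-tabulate P? (f ∘ suc))
... | false = length-filter-tabulate P? (f ∘ suc)

least : ∀ {n} {P : Fin n → Set} → Decidable P → ∃ P → ∃ λ i → P i × (∀ j → P j → toℕ i ≤ toℕ j)
least {suc n} {P} P? (k , pk) with P? zero
... | yes p = zero , p , λ _ _ → z≤n
... | no ¬p = suc i , pi , minimal
  where
  witness : ∃ (P ∘ suc)
  witness = shift k pk
    where
    shift : ∀ k → P k → ∃ (P ∘ suc)
    shift zero    p = contradiction p ¬p
    shift (suc k) p = k , p
  tail = least (P? ∘ suc) witness
  i = proj₁ tail
  pi = proj₁ (proj₂ tail)
  minimal : ∀ j → P j → suc (toℕ i) ≤ toℕ j
  minimal zero    p = contradiction p ¬p
  minimal (suc j) p = s≤s (proj₂ (proj₂ tail) j p)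

-- Orbits of permutations

module _ {A : Set} (f : A → A) where

  iter-+ : ∀ a b x → iter f (a + b) x ≡ iter f a (iter f b x)
  iter-+ zero    b x = refl
  iter-+ (suc a) b x = cong f (iter-+ a b x)

  iter-* : ∀ {p x} q → iter f p x ≡ x → iter f (q * p) x ≡ x
  iter-* zero    eq = refl
  iter-* {p} {x} (suc q) eq = trans (iter-+ p (q * p) x) (trans (cong (iter f p) (iter-* q eq)) eq)

  iter-injective : (∀ {x y} → f x ≡ f y → x ≡ y) → ∀ k {x y} → iter f k x ≡ iter f k y → x ≡ y
  iter-injective inj zero    eq = eq
  iter-injective inj (suc k) eq = iter-injective inj k (inj eq)

  invariant-iter : {B : Set} (h : A → B) → (∀ x → h (f x) ≡ h x) → ∀ k x → h (iter f k x) ≡ h x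
  invariant-iter h inv zero    x = refl
  invariant-iter h inv (suc k) x = trans (inv _) (invariant-iter h inv k x)

  invariant-orbit : {B : Set} (h : A → B) → (∀ x → h (f x) ≡ h x) → ∀ {x y} → Orbit f x y → h x ≡ h y
  invariant-orbit h inv (k , refl) = sym (invariant-iter h inv k _)

  orbit-refl : ∀ {x} → Orbit f x x
  orbit-refl = 0 , refl

  orbit-step : ∀ {x} → Orbit f x (f x)
  orbit-step = 1 , refl

  orbit-trans : ∀ {x y z} → Orbit f x y → Orbit f y z → Orbit f x z
  orbit-trans {x} (a , refl) (b , refl) = b + a , iter-+ b a x

module OrbitProperties {n : ℕ} (f : Fin n → Fin n) (f-injective : ∀ {x y} → f x ≡ f y → x ≡ y) where

  period : ∀ x → ∃[ p ] p < n × iter f (suc p) x ≡ x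
  period x with i , j , i<j , eq ← pigeonhole {n} {suc n} ℕ.≤-refl (λ k → iter f (toℕ k) x) =
    p , ℕ.≤-trans (ℕ.≤-reflexive p+1) (ℕ.≤-trans (ℕ.m∸n≤m (toℕ j) (toℕ i)) (ℕ.≤-pred (toℕ<n j))) ,
    iter-injective f f-injective (toℕ i) (trans (sym (iter-+ f (toℕ i) (suc p) x))
      (trans (cong (λ k → iter f k x) i+p) (sym eq)))
    where
    p = toℕ j ∸ suc (toℕ i)
    p+1 : suc p ≡ toℕ j ∸ toℕ i
    p+1 = sym (ℕ.+-∸-assoc 1 i<j)
    i+p : toℕ i + suc p ≡ toℕ j
    i+p = trans (cong (toℕ i +_) p+1) (ℕ.m+[n∸m]≡n (ℕ.<⇒≤ i<j))

  -- `k * p` further steps undo `k` steps, because `k + k * p = k * suc p` is a multiple of the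
  -- period `suc p`.
  orbit-sym : ∀ {x y} → Orbit f x y → Orbit f y x
  orbit-sym {x} (k , refl) with p , _ , eq ← period x =
    k * p , trans (sym (iter-+ f (k * p) k x))
      (trans (cong (λ m → iter f m x) (trans (ℕ.+-comm (k * p) k) (sym (ℕ.*-suc k p)))) (iter-* f k eq))

  -- Reducing the exponent modulo the period brings it below `n`, the range over which `OrbitMin`
  -- quantifies. It also makes orbit membership decidable.
  orbit-bounded : ∀ {x y} → Orbit f x y → ∃[ k ] iter f (toℕ {n} k) x ≡ y
  orbit-bounded {x} (k , refl) with p , p<n , eq ← period x =
    fromℕ< r<n , trans (cong (λ m → iter f m x) (toℕ-fromℕ< r<n))
      (trans (cong (iter f r) (sym (iter-* f (k / suc p) eq)))
        (trans (sym (iter-+ f r _ x)) (cong (λ m → iter f m x) (sym (m≡m%n+[m/n]*n k (suc p))))))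
    where
    r = k % suc p
    r<n : r < n
    r<n = ℕ.<-≤-trans (m%n<n k (suc p)) p<n

  orbit? : ∀ x y → Dec (Orbit f x y)
  orbit? x y with any? (λ k → iter f (toℕ {n} k) x ≟ y)
  ... | yes (k , eq) = yes (toℕ k , eq)
  ... | no ¬k = no (¬k ∘ orbit-bounded)

  private
    leastInOrbit : ∀ x → ∃ λ i → Orbit f x i × (∀ j → Orbit f x j → toℕ i ≤ toℕ j)
    leastInOrbit x = least (orbit? x) (x , orbit-refl f)

  rep : Fin n → Fin n
  rep x = proj₁ (leastInOrbit x)

  rep-orbit : ∀ x → Orbit f x (rep x)
  rep-orbit x = proj₁ (proj₂ (leastInOrbit x))

  rep-min : ∀ {x y} → Orbit f x y → toℕ (rep x) ≤ toℕ y
  rep-min {x} {y} = proj₂ (proj₂ (leastInOrbit x)) y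

  rep-cong : ∀ {x y} → Orbit f x y → rep x ≡ rep y
  rep-cong {x} {y} o = toℕ-injective (ℕ.≤-antisym
    (rep-min (orbit-trans f o (rep-orbit y)))
    (rep-min (orbit-trans f (orbit-sym o) (rep-orbit x))))

  rep-idem : ∀ x → rep (rep x) ≡ rep x
  rep-idem x = sym (rep-cong (rep-orbit x))

-- Partitions are encoded as idempotent maps that choose a representative; the classes are then
-- counted by the fixed points.
fixedPoints : ∀ {n} → (Fin n → Fin n) → ℕ
fixedPoints r = ∑ (λ x → b2n (does (r x ≟ x)))

numOrbits-rep : ∀ (G : Map) (f : Fin (Map.n G) → Fin (Map.n G)) (inj : ∀ {x y} → f x ≡ f y → x ≡ y) →
                numOrbits G f ≡ fixedPoints (OrbitProperties.rep f inj)
numOrbits-rep G f inj = trans (length-filter-tabulate (orbitMin? G f) id)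
  (∑-cong λ x → cong b2n (does-⇔ (mk⇔ (to x) (from x)) (orbitMin? G f x) (rep x ≟ x)))
  where
  open OrbitProperties f inj
  to : ∀ x → OrbitMin G f x → rep x ≡ x
  to x min with k , eq ← orbit-bounded (rep-orbit x) =
    toℕ-injective (ℕ.≤-antisym (rep-min (orbit-refl f)) (subst (λ y → toℕ x ≤ toℕ y) eq (min k)))
  from : ∀ x → rep x ≡ x → OrbitMin G f x
  from x eq k = subst (λ y → toℕ y ≤ toℕ (iter f (toℕ k) x)) eq (rep-min (toℕ k , refl))

-- Spanning forests

private
  if-true : ∀ {A B : Set} (d : Dec A) {x y : B} → A → (if does d then x else y) ≡ x
  if-true d a rewrite dec-true d a = refl
  if-false : ∀ {A B : Set} (d : Dec A) {x y : B} → ¬ A → (if does d then x else y) ≡ y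
  if-false d a rewrite dec-false d a = refl

-- The outcome of Kruskal's algorithm, started at the partition of `r₀` and ending at that of `r`.
-- `realize` says that the tree edges are independent mod 2: any bits on them are the differences of
-- one labelling of the classes of `r₀`. `generated` says that `r` is the finest partition coarser
-- than `r₀` that joins the listed edges.
record Forest {n : ℕ} {E : Set} (src tgt : E → Fin n) (r₀ : Fin n → Fin n) (es : List E) : Set₁ where
  field
    tree rest : List E
    r         : Fin n → Fin n
    r-idem    : ∀ x → r (r x) ≡ r x
    coarser   : ∀ {x y} → r₀ x ≡ r₀ y → r x ≡ r y
    joins     : ∀ {e} → e ∈ es → r (src e) ≡ r (tgt e)
    tree⊆     : ∀ {e} → e ∈ tree → e ∈ es
    split     : ∀ {e} → e ∈ es → e ∈ tree ⊎ e ∈ rest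
    lengths   : length es ≡ length tree + length rest
    count     : fixedPoints r₀ ≡ length tree + fixedPoints r
    realize   : (B : E → Bool) → Σ (Fin n → Bool) λ t → (∀ {x y} → r₀ x ≡ r₀ y → t x ≡ t y)
                × (∀ {e} → e ∈ tree → t (src e) xor t (tgt e) ≡ B e)
    generated : (R : Rel (Fin n) 0ℓ) → IsEquivalence R → (∀ {x y} → r₀ x ≡ r₀ y → R x y) →
                (∀ {e} → e ∈ es → R (src e) (tgt e)) → ∀ {x y} → r x ≡ r y → R x y

module _ {n : ℕ} (r : Fin n → Fin n) (r-idem : ∀ x → r (r x) ≡ r x) (a b : Fin n) where

  merge : Fin n → Fin n
  merge x = if does (r x ≟ r a) then r b else r x

  merge-cong : ∀ {x y} → r x ≡ r y → merge x ≡ merge y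
  merge-cong eq rewrite eq = refl

  module _ (ra≢rb : r a ≢ r b) where

    merge-joins : merge a ≡ merge b
    merge-joins = trans (if-true (r a ≟ r a) refl) (sym (if-false (r b ≟ r a) (ra≢rb ∘ sym)))

    merge-idem : ∀ x → merge (merge x) ≡ merge x
    merge-idem x with r x ≟ r a
    ... | yes _ = trans (if-false (r (r b) ≟ r a) (λ eq → ra≢rb (sym (trans (sym (r-idem b)) eq)))) (r-idem b)
    ... | no ¬p = trans (if-false (r (r x) ≟ r a) (λ eq → ¬p (trans (sym (r-idem x)) eq))) (r-idem x)

    merge-reflects : ∀ {x y} → merge x ≡ merge y →
      r x ≡ r y ⊎ (r x ≡ r a × r y ≡ r b) ⊎ (r x ≡ r b × r y ≡ r a)
    merge-reflects {x} {y} eq with r x ≟ r a | r y ≟ r a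
    ... | yes p | yes q = inj₁ (trans p (sym q))
    ... | yes p | no  _ = inj₂ (inj₁ (p , sym eq))
    ... | no  _ | yes q = inj₂ (inj₂ (eq , q))
    ... | no  _ | no  _ = inj₁ eq

    -- Only `r a` stops being a fixed point, since its class is redirected to `r b`.
    fixedPoints-merge : fixedPoints r ≡ suc (fixedPoints merge)
    fixedPoints-merge = trans (∑-cong pointwise) (trans (∑-distrib-+ (λ x → b2n (does (x ≟ r a))) (λ x → b2n (does (merge x ≟ x))))
      (cong (_+ fixedPoints merge) (trans (∑-point (r a) _ (λ x x≢ → cong b2n (dec-false (x ≟ r a) x≢)))
        (cong b2n (dec-true (r a ≟ r a) refl)))))
      where
      pointwise : ∀ x → b2n (does (r x ≟ x)) ≡ b2n (does (x ≟ r a)) + b2n (does (merge x ≟ x))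
      pointwise x with x ≟ r a
      ... | yes refl = trans (cong b2n (dec-true (r (r a) ≟ r a) (r-idem a)))
              (cong (λ k → 1 + b2n k) (sym (dec-false (merge (r a) ≟ r a)
                (λ eq → ra≢rb (sym (trans (sym (if-true (r (r a) ≟ r a) (r-idem a))) eq))))))
      ... | no x≢ra with r x ≟ r a
      ...   | yes p = cong b2n (trans (dec-false (r x ≟ x) (λ q → x≢ra (trans (sym q) p)))
                (sym (dec-false (r b ≟ x) (λ q → ra≢rb (sym (trans (trans (sym (r-idem b)) (cong r q)) p))))))
      ...   | no ¬p = refl

forest : ∀ {n} {E : Set} (src tgt : E → Fin n) (r₀ : Fin n → Fin n) → (∀ x → r₀ (r₀ x) ≡ r₀ x) →
         (es : List E) → Forest src tgt r₀ es
forest src tgt r₀ idem [] = record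
  { tree = [] ; rest = [] ; r = r₀ ; r-idem = idem ; coarser = id
  ; joins = λ () ; tree⊆ = id ; split = λ () ; lengths = refl ; count = refl
  ; realize = λ _ → (λ _ → false) , (λ _ → refl) , λ ()
  ; generated = λ _ _ r₀⇒R _ → r₀⇒R
  }
forest src tgt r₀ idem (e ∷ es) with forest src tgt r₀ idem es
... | F with Forest.r F (src e) ≟ Forest.r F (tgt e)
... | yes joined = record
  { tree = tree ; rest = e ∷ rest ; r = r ; r-idem = r-idem ; coarser = coarser
  ; joins = λ { (here refl) → joined ; (there m) → joins m }
  ; tree⊆ = there ∘ tree⊆
  ; split = λ { (here eq) → inj₂ (here eq)
              ; (there m) → [ inj₁ , (λ q → inj₂ (there q)) ]′ (split m) }
  ; lengths = trans (cong suc lengths) (sym (ℕ.+-suc (length tree) (length rest)))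
  ; count = count ; realize = realize
  ; generated = λ R eqv r₀⇒R es⇒R → generated R eqv r₀⇒R (es⇒R ∘ there)
  }
  where open Forest F
... | no apart = record
  { tree = e ∷ tree ; rest = rest ; r = merge r r-idem a b
  ; r-idem = merge-idem r r-idem a b apart
  ; coarser = merge-cong r r-idem a b ∘ coarser
  ; joins = λ { (here refl) → merge-joins r r-idem a b apart
              ; (there m) → merge-cong r r-idem a b (joins m) }
  ; tree⊆ = λ { (here eq) → here eq ; (there m) → there (tree⊆ m) }
  ; split = λ { (here eq) → inj₁ (here eq)
              ; (there m) → [ (λ q → inj₁ (there q)) , inj₂ ]′ (split m) }
  ; lengths = cong suc lengths
  ; count = trans count (trans (cong (length tree +_) (fixedPoints-merge r r-idem a b apart))
                               (ℕ.+-suc (length tree) _))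
  ; realize = realize′
  ; generated = generated′
  }
  where
  open Forest F
  a = src e
  b = tgt e
  generated′ : (R : Rel _ 0ℓ) → IsEquivalence R → (∀ {x y} → r₀ x ≡ r₀ y → R x y) →
               (∀ {e′} → e′ ∈ e ∷ es → R (src e′) (tgt e′)) →
               ∀ {x y} → merge r r-idem a b x ≡ merge r r-idem a b y → R x y
  generated′ R eqv r₀⇒R es⇒R eq with merge-reflects r r-idem a b apart eq
  ... | inj₁ p = generated R eqv r₀⇒R (es⇒R ∘ there) p
  ... | inj₂ (inj₁ (p , q)) =
    R.trans (old p) (R.trans (es⇒R (here refl)) (R.sym (old q)))
    where
    module R = IsEquivalence eqv
    old : ∀ {x y} → r x ≡ r y → R x y
    old = generated R eqv r₀⇒R (es⇒R ∘ there)
  ... | inj₂ (inj₂ (p , q)) =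
    R.trans (old p) (R.trans (R.sym (es⇒R (here refl))) (R.sym (old q)))
    where
    module R = IsEquivalence eqv
    old : ∀ {x y} → r x ≡ r y → R x y
    old = generated R eqv r₀⇒R (es⇒R ∘ there)
  realize′ : ∀ B → Σ (Fin _ → Bool) λ t → (∀ {x y} → r₀ x ≡ r₀ y → t x ≡ t y)
             × (∀ {e′} → e′ ∈ e ∷ tree → t (src e′) xor t (tgt e′) ≡ B e′)
  realize′ B with t , t-inv , t-tree ← realize B = t′ , t′-inv , t′-tree
    where
    -- Adding a constant on one class of r changes nothing on the older tree edges.
    bit = (t a xor t b) xor B e
    t′ : _ → Bool
    t′ x = t x xor (does (r x ≟ r a) ∧ bit)
    t′-inv : ∀ {x y} → r₀ x ≡ r₀ y → t′ x ≡ t′ y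
    t′-inv {x} {y} eq = cong₂ (λ p q → p xor (does (q ≟ r a) ∧ bit)) (t-inv eq) (coarser eq)
    cancel : ∀ p q c → (p xor c) xor (q xor c) ≡ p xor q
    cancel true  true  true  = refl
    cancel true  true  false = refl
    cancel true  false true  = refl
    cancel true  false false = refl
    cancel false true  true  = refl
    cancel false true  false = refl
    cancel false false true  = refl
    cancel false false false = refl
    adjust : ∀ p q c → (p xor ((p xor q) xor c)) xor (q xor false) ≡ c
    adjust true  true  true  = refl
    adjust true  true  false = refl
    adjust true  false true  = refl
    adjust true  false false = refl
    adjust false true  true  = refl
    adjust false true  false = refl
    adjust false false true  = refl
    adjust false false false = refl
    t′-tree : ∀ {e′} → e′ ∈ e ∷ tree → t′ (src e′) xor t′ (tgt e′) ≡ B e′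
    t′-tree (here refl) = trans
      (cong₂ (λ p q → (t a xor (p ∧ bit)) xor (t b xor (q ∧ bit)))
             (dec-true (r a ≟ r a) refl) (dec-false (r b ≟ r a) (apart ∘ sym)))
      (adjust (t a) (t b) (B e))
    t′-tree {e′} (there m) = trans
      (trans (cong (λ q → (t (src e′) xor (does (r (src e′) ≟ r a) ∧ bit)) xor (t (tgt e′) xor (does (q ≟ r a) ∧ bit)))
                   (sym (joins (tree⊆ m))))
             (cancel (t (src e′)) (t (tgt e′)) _))
      (t-tree m)

-- The two-colouring that marks the class of `x` in the generated partition is constant across the
-- edges, so it marks `y` too, and `generated` converts equality of classes into `R`.
cut-connected : ∀ {n} {E : Set} (src tgt : E → Fin n) (es : List E)
  (R : Rel (Fin n) 0ℓ) → IsEquivalence R → (∀ {e} → e ∈ es → R (src e) (tgt e)) → ∀ x y →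
  ((t : Fin n → Bool) → (∀ {e} → e ∈ es → t (src e) ≡ t (tgt e)) → t x ≡ t y) → R x y
cut-connected src tgt es R eqv es⇒R x y const =
  generated R eqv (λ { refl → IsEquivalence.refl eqv }) es⇒R rx≡ry
  where
  open Forest (forest src tgt id (λ _ → refl) es)
  class = const (λ z → does (r z ≟ r x)) (λ m → cong (λ q → does (q ≟ r x)) (joins m))
  rx≡ry : r x ≡ r y
  rx≡ry with r y ≟ r x | class
  ... | yes p | _ = sym p
  ... | no _  | eq with () ← trans (sym (dec-true (r x ≟ r x) refl)) eq

-- Cubic maps: vertex sets, face sets and edge sets mod 2

module CubicMap (G : Map) (involution : IsInvolution G) (cubic : Cubic G) where
  open Map G public

  ϕ : Fin n → Fin n
  ϕ = φ G

  ϕ⁻ : Fin n → Fin n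
  ϕ⁻ d = α (σ (σ d))

  α² : ∀ d → α (α d) ≡ d
  α² = proj₁ involution

  α≢ : ∀ d → α d ≢ d
  α≢ = proj₂ involution

  σ³ : ∀ d → σ (σ (σ d)) ≡ d
  σ³ = proj₁ ∘ cubic

  σ≢ : ∀ d → σ d ≢ d
  σ≢ = proj₂ ∘ cubic

  α-injective : ∀ {x y} → α x ≡ α y → x ≡ y
  α-injective {x} {y} eq = trans (sym (α² x)) (trans (cong α eq) (α² y))

  σ-injective : ∀ {x y} → σ x ≡ σ y → x ≡ y
  σ-injective {x} {y} eq = trans (sym (σ³ x)) (trans (cong (σ ∘ σ) eq) (σ³ y))

  ϕ-injective : ∀ {x y} → ϕ x ≡ ϕ y → x ≡ y
  ϕ-injective = α-injective ∘ σ-injective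

  ϕϕ⁻ : ∀ d → ϕ (ϕ⁻ d) ≡ d
  ϕϕ⁻ d = trans (cong σ (α² _)) (σ³ d)

  ϕ⁻ϕ : ∀ d → ϕ⁻ (ϕ d) ≡ d
  ϕ⁻ϕ d = trans (cong α (σ³ _)) (α² d)

  ϕα : ∀ d → ϕ (α d) ≡ σ d
  ϕα d = cong σ (α² d)

  module Vertex = OrbitProperties σ σ-injective
  module Face = OrbitProperties ϕ ϕ-injective

  _~V_ _~F_ : Fin n → Fin n → Set
  _~V_ = Orbit σ
  _~F_ = Orbit ϕ

  ϕ⁻-orbit : ∀ d → ϕ⁻ d ~F d
  ϕ⁻-orbit d = 1 , ϕϕ⁻ d

  σ-Invariant ϕ-Invariant : {A : Set} → (Fin n → A) → Set
  σ-Invariant h = ∀ d → h (σ d) ≡ h d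
  ϕ-Invariant h = ∀ d → h (ϕ d) ≡ h d

  ϕ-inv-α : {A : Set} {h : Fin n → A} → ϕ-Invariant h → ∀ d → h (α d) ≡ h (σ d)
  ϕ-inv-α {h = h} inv d = trans (sym (inv (α d))) (cong h (ϕα d))

  reach-invariant : {A : Set} (h : Fin n → A) → σ-Invariant h → ∀ {E P u v} →
    (∀ w → E w → h (α w) ≡ h w) → Reach G E P u v → h u ≡ h v
  reach-invariant h inv h-α (here u~v) = invariant-orbit σ h inv u~v
  reach-invariant h inv h-α (step w u~w e _ rest) =
    trans (invariant-orbit σ h inv u~w) (trans (sym (h-α w e)) (reach-invariant h inv h-α rest))

  -- The coboundary mod 2: an edge cut if `t` is a vertex set (`σ`-invariant), the boundary of a
  -- face set if `t` is `ϕ`-invariant.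
  δ : (Fin n → Bool) → Fin n → Bool
  δ t d = t d xor t (α d)

  δ-α : ∀ t d → δ t (α d) ≡ δ t d
  δ-α t d = trans (cong (λ x → t (α d) xor t x) (α² d)) (xor-comm (t (α d)) (t d))

  ⨁-δ : (t h : Fin n → Bool) → ⨁ (λ d → h d ∧ δ t d) ≡ ⨁ (λ d → h d ∧ t d) xor ⨁ (λ d → h d ∧ t (α d))
  ⨁-δ t h = trans (⨁-cong λ d → ∧-distribˡ-xor (h d) (t d) (t (α d)))
                  (⨁-distrib-xor (λ d → h d ∧ t d) (λ d → h d ∧ t (α d)))

  -- `ϕ d` and `α d` are darts of the same vertex, so the two halves of the sum agree after a shift
  -- by `ϕ`: a cut meets every face boundary evenly.
  δV-orthogonal : ∀ t h → σ-Invariant t → ϕ-Invariant h → ⨁ (λ d → h d ∧ δ t d) ≡ false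
  δV-orthogonal t h t-inv h-inv = trans (⨁-δ t h) (xor-false (sym (trans
    (⨁-cong λ d → cong₂ _∧_ (sym (h-inv d)) (sym (t-inv (α d))))
    (⨁-reindex ϕ ϕ⁻ ϕϕ⁻ ϕ⁻ϕ (λ d → h d ∧ t d)))))

  -- Dually, `α d` and `σ d` lie on the same face, so the shift is by `σ`.
  δF-orthogonal : ∀ t h → ϕ-Invariant t → σ-Invariant h → ⨁ (λ d → h d ∧ δ t d) ≡ false
  δF-orthogonal t h t-inv h-inv = trans (⨁-δ t h) (xor-false (sym (trans
    (⨁-cong λ d → cong₂ _∧_ (sym (h-inv d)) (ϕ-inv-α t-inv d))
    (⨁-reindex σ (σ ∘ σ) σ³ σ³ (λ d → h d ∧ t d)))))

  -- Each edge is listed through its lesser dart.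
  edges : List (Fin n)
  edges = filter (orbitMin? G α) (allFin n)

  lesser : Fin n → Bool
  lesser d = does (toℕ d ≤? toℕ (α d))

  lesser-α : ∀ d → lesser (α d) ≡ not (lesser d)
  lesser-α d = does-⇔ (mk⇔ to from) (toℕ (α d) ≤? toℕ (α (α d))) (¬? (toℕ d ≤? toℕ (α d)))
    where
    to : toℕ (α d) ≤ toℕ (α (α d)) → ¬ toℕ d ≤ toℕ (α d)
    to q p = α≢ d (toℕ-injective (ℕ.≤-antisym (subst (λ x → toℕ (α d) ≤ toℕ x) (α² d) q) p))
    from : ¬ toℕ d ≤ toℕ (α d) → toℕ (α d) ≤ toℕ (α (α d))
    from ¬p = subst (λ x → toℕ (α d) ≤ toℕ x) (sym (α² d)) (ℕ.<⇒≤ (ℕ.≰⇒> ¬p))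

  lesser⇒∈edges : ∀ {d} → lesser d ≡ true → d ∈ edges
  lesser⇒∈edges {d} eq = ∈-filter⁺ (orbitMin? G α) (∈-allFin d) λ k → [ (λ q → ℕ.≤-reflexive (cong toℕ (sym q))) ,
                  (λ q → subst (λ x → toℕ d ≤ toℕ x) (sym q) (does-true (toℕ d ≤? toℕ (α d)) eq)) ]′ (iter-α (toℕ k))
    where
    iter-α : ∀ k → iter α k d ≡ d ⊎ iter α k d ≡ α d
    iter-α zero = inj₁ refl
    iter-α (suc k) = [ inj₂ ∘ cong α , (λ q → inj₁ (trans (cong α q) (α² d))) ]′ (iter-α k)

  ∈edges⇒lesser : ∀ {d} → d ∈ edges → lesser d ≡ true
  ∈edges⇒lesser {d} m
    with k , eq ← OrbitProperties.orbit-bounded α α-injective (orbit-step α {d}) =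
    dec-true (toℕ d ≤? toℕ (α d))
      (subst (λ x → toℕ d ≤ toℕ x) eq (proj₂ (∈-filter⁻ (orbitMin? G α) {xs = allFin n} m) k))

  edgewise : {P : Fin n → Set} → (∀ {d} → P (α d) → P d) → (∀ {d} → d ∈ edges → P d) → ∀ d → P d
  edgewise {P} P-α P-edges d with lesser d in eq
  ... | true  = P-edges (lesser⇒∈edges eq)
  ... | false = P-α (P-edges (lesser⇒∈edges (trans (lesser-α d) (cong not eq))))

  ⨁-edges : ∀ h → ⨁ h ≡ ⨁ (λ d → lesser d ∧ (h d xor h (α d)))
  ⨁-edges h = trans (⨁-cong split) (trans (⨁-distrib-xor (λ d → lesser d ∧ h d) (λ d → not (lesser d) ∧ h d))
    (trans (cong (⨁ (λ d → lesser d ∧ h d) xor_) swap)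
    (trans (sym (⨁-distrib-xor (λ d → lesser d ∧ h d) (λ d → lesser d ∧ h (α d))))
      (⨁-cong λ d → sym (∧-distribˡ-xor (lesser d) (h d) (h (α d)))))))
    where
    split : ∀ d → h d ≡ (lesser d ∧ h d) xor (not (lesser d) ∧ h d)
    split d with lesser d
    ... | true  = sym (xor-identityʳ (h d))
    ... | false = refl
    swap : ⨁ (λ d → not (lesser d) ∧ h d) ≡ ⨁ (λ d → lesser d ∧ h (α d))
    swap = trans (⨁-cong λ d → cong₂ _∧_ (sym (lesser-α d)) (cong h (sym (α² d))))
                 (⨁-reindex α α α² α² (λ d → lesser d ∧ h (α d)))

  -- Summation by parts: pairing `B` with `t` over darts is pairing `B` with `δ t` over edges. If
  -- `δ t` is the indicator of `e` on the tree, only the term `B e` survives, because `B` vanishes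
  -- off the tree.
  independent : {Inv : (Fin n → Bool) → Set} (tree : List (Fin n)) →
    ((B : Fin n → Bool) → Σ (Fin n → Bool) λ t → Inv t × (∀ {e} → e ∈ tree → δ t e ≡ B e)) →
    (B : Fin n → Bool) → (∀ d → B (α d) ≡ B d) → (∀ t → Inv t → ⨁ (λ d → t d ∧ B d) ≡ false) →
    (∀ {d} → d ∈ edges → d ∈ tree ⊎ B d ≡ false) → ∀ {e} → e ∈ edges → e ∈ tree → B e ≡ false
  independent tree realize B B-α B⊥ support {e} e∈edges e∈tree
    with t , t-inv , t-tree ← realize (λ d → does (d ≟ e)) =
    trans (sym at-e) (trans (sym (⨁-point e h off-e)) (trans (sym sum-h) (B⊥ t t-inv)))
    where
    h : Fin n → Bool
    h d = lesser d ∧ (δ t d ∧ B d)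
    sum-h : ⨁ (λ d → t d ∧ B d) ≡ ⨁ h
    sum-h = trans (⨁-edges (λ d → t d ∧ B d)) (⨁-cong λ d → cong (lesser d ∧_)
      (trans (cong (λ b → (t d ∧ B d) xor (t (α d) ∧ b)) (B-α d)) (sym (distrib (B d) (t d) (t (α d))))))
      where
      distrib : ∀ b p q → (p xor q) ∧ b ≡ (p ∧ b) xor (q ∧ b)
      distrib b p q = trans (∧-comm (p xor q) b) (trans (∧-distribˡ-xor b p q)
                        (cong₂ _xor_ (∧-comm b p) (∧-comm b q)))
    off-e : ∀ d → d ≢ e → h d ≡ false
    off-e d d≢e with lesser d in eq
    ... | false = refl
    ... | true with support (lesser⇒∈edges eq)
    ...   | inj₁ d∈tree = cong (_∧ B d) (trans (t-tree d∈tree) (dec-false (d ≟ e) d≢e))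
    ...   | inj₂ Bd = trans (cong (δ t d ∧_) Bd) (∧-zeroʳ (δ t d))
    at-e : h e ≡ B e
    at-e = trans (cong (_∧ (δ t e ∧ B e)) (∈edges⇒lesser e∈edges))
                 (cong (_∧ B e) (trans (t-tree e∈tree) (dec-true (e ≟ e) refl)))

fixedPoints-constant : ∀ {n} (r : Fin n → Fin n) → (∀ x → r (r x) ≡ r x) →
                       ∀ x → (∀ y → r y ≡ r x) → fixedPoints r ≡ 1
fixedPoints-constant r idem x const = trans
  (∑-point (r x) _ λ y y≢ → cong b2n (dec-false (r y ≟ y) λ eq → y≢ (trans (sym eq) (const y))))
  (cong b2n (dec-true (r (r x) ≟ r x) (idem x)))

-- Tree–cotree decomposition: by Euler's formula the edges outside a spanning tree are exactly the
-- edges of a spanning tree of the dual.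
module PlanarMap (G : Map) (involution : IsInvolution G) (cubic : Cubic G) (planar : Planar G)
                 (o : Fin (Map.n G)) where
  open CubicMap G involution cubic public

  invariant-constant : {A : Set} (h : Fin n → A) → σ-Invariant h → (∀ d → h (α d) ≡ h d) → ∀ x y → h x ≡ h y
  invariant-constant h inv h-α x y = reach-invariant h inv (λ w _ → h-α w) (proj₁ planar x y tt tt)

  module TreeCotree (primal : Forest id α Vertex.rep edges)
                    (dual : Forest id α Face.rep (Forest.rest primal)) where
    private
      module T = Forest primal
      module F = Forest dual

    realizeT : ∀ B → Σ (Fin n → Bool) λ t → σ-Invariant t × (∀ {e} → e ∈ T.tree → δ t e ≡ B e)
    realizeT B with t , t-inv , t-tree ← T.realize B =
      t , (λ d → t-inv (sym (Vertex.rep-cong (orbit-step σ)))) , t-tree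

    realizeF : ∀ B → Σ (Fin n → Bool) λ t → ϕ-Invariant t × (∀ {e} → e ∈ F.tree → δ t e ≡ B e)
    realizeF B with t , t-inv , t-tree ← F.realize B =
      t , (λ d → t-inv (sym (Face.rep-cong (orbit-step ϕ)))) , t-tree

    T-constant : ∀ x y → T.r x ≡ T.r y
    T-constant = invariant-constant T.r (λ d → T.coarser (sym (Vertex.rep-cong (orbit-step σ))))
      (edgewise {λ d → T.r (α d) ≡ T.r d} (λ {d} eq → trans (sym eq) (cong T.r (α² d))) (sym ∘ T.joins))

    -- A face set whose boundary avoids the cotree has its boundary in the tree, so has no boundary.
    F-constant : ∀ x y → F.r x ≡ F.r y
    F-constant x y with F.r x ≟ F.r y | invariant-constant t (λ d → trans (sym (ϕ-inv-α t-ϕ d)) (t-α d)) t-α x y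
      where
      t : Fin n → Bool
      t z = does (F.r z ≟ F.r y)
      t-ϕ : ϕ-Invariant t
      t-ϕ d = cong (λ q → does (q ≟ F.r y)) (F.coarser (sym (Face.rep-cong (orbit-step ϕ))))
      δt≡0 : ∀ d → δ t d ≡ false
      δt≡0 = edgewise (λ {d} eq → trans (sym (δ-α t d)) eq) λ e∈ →
        [ independent T.tree realizeT (δ t) (δ-α t) (λ h h-inv → δF-orthogonal t h t-ϕ h-inv)
            (λ d∈ → [ inj₁ , (λ d∈rest → inj₂ (xor-false (cong (λ q → does (q ≟ F.r y)) (F.joins d∈rest)))) ]′ (T.split d∈)) e∈
        , (λ e∈rest → xor-false (cong (λ q → does (q ≟ F.r y)) (F.joins e∈rest))) ]′ (T.split e∈)
      t-α : ∀ d → t (α d) ≡ t d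
      t-α d = sym (xor-≡ (δt≡0 d))
    ... | yes p | _ = p
    ... | no _ | eq with () ← trans eq (dec-true (F.r y ≟ F.r y) refl)

    vertices : numOrbits G σ ≡ length T.tree + 1
    vertices = trans (numOrbits-rep G σ σ-injective) (trans T.count
      (cong (length T.tree +_) (fixedPoints-constant T.r T.r-idem o (λ y → T-constant y o))))

    faces : numOrbits G ϕ ≡ length F.tree + 1
    faces = trans (numOrbits-rep G ϕ ϕ-injective) (trans F.count
      (cong (length F.tree +_) (fixedPoints-constant F.r F.r-idem o (λ y → F-constant y o))))

    -- Primal and dual trees have one edge less than there are vertices and faces. Euler's formula
    -- then makes the dual tree as large as `T.rest`, the set it was selected from.
    rest-empty : length F.rest ≡ 0
    rest-empty = sym (ℕ.+-cancelˡ-≡ (length F.tree) _ _ (trans (ℕ.+-identityʳ _)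
      (trans (ℕ.+-cancelˡ-≡ (length T.tree) _ _ (ℕ.+-cancelʳ-≡ 2 _ _ euler)) F.lengths)))
      where
      rearrange : ∀ a b → (a + 1) + (b + 1) ≡ (a + b) + 2
      rearrange a b = trans (ℕ.+-assoc a 1 (b + 1)) (trans (cong (λ c → a + suc c) (ℕ.+-comm b 1))
        (trans (cong (a +_) (ℕ.+-comm 2 b)) (sym (ℕ.+-assoc a b 2))))
      euler : (length T.tree + length F.tree) + 2 ≡ (length T.tree + length T.rest) + 2
      euler = trans (sym (rearrange (length T.tree) (length F.tree)))
        (trans (cong₂ _+_ (sym vertices) (sym faces)) (trans (proj₂ planar) (cong (_+ 2) T.lengths)))

    rest⊆F : ∀ {e} → e ∈ T.rest → e ∈ F.tree
    rest⊆F e∈ = [ id , (λ e∈rest → ⊥-elim (empty F.rest rest-empty e∈rest)) ]′ (F.split e∈)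
      where
      empty : ∀ (es : List (Fin n)) {e} → length es ≡ 0 → ¬ e ∈ es
      empty [] _ ()

    -- Take a cut that agrees with `B` on the primal tree. The difference lives on the cotree and is
    -- orthogonal to all face sets, so it vanishes because the cotree is a tree of the dual.
    even-is-cut : (B : Fin n → Bool) → (∀ d → B (α d) ≡ B d) →
             (∀ h → ϕ-Invariant h → ⨁ (λ d → h d ∧ B d) ≡ false) →
             Σ (Fin n → Bool) λ t → σ-Invariant t × (∀ d → δ t d ≡ B d)
    even-is-cut B B-α B⊥ with t , t-inv , t-tree ← realizeT B = t , t-inv , λ d → sym (xor-≡ (zero-diff d))
      where
      D : Fin n → Bool
      D d = B d xor δ t d
      D-α : ∀ d → D (α d) ≡ D d
      D-α d = cong₂ _xor_ (B-α d) (δ-α t d)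
      D⊥ : ∀ h → ϕ-Invariant h → ⨁ (λ d → h d ∧ D d) ≡ false
      D⊥ h h-inv = trans (⨁-cong λ d → ∧-distribˡ-xor (h d) (B d) (δ t d))
        (trans (⨁-distrib-xor (λ d → h d ∧ B d) (λ d → h d ∧ δ t d))
               (cong₂ _xor_ (B⊥ h h-inv) (δV-orthogonal t h t-inv h-inv)))
      tree-zero : ∀ {d} → d ∈ T.tree → D d ≡ false
      tree-zero d∈ = xor-false (sym (t-tree d∈))
      zero-diff : ∀ d → D d ≡ false
      zero-diff = edgewise (λ {d} eq → trans (sym (D-α d)) eq) λ e∈ →
        [ tree-zero
        , (λ e∈rest → independent F.tree realizeF D D-α D⊥
             (λ d∈ → [ inj₂ ∘ tree-zero , inj₁ ∘ rest⊆F ]′ (T.split d∈)) e∈ (rest⊆F e∈rest)) ]′ (T.split e∈)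

  -- The combinatorial Jordan curve theorem: a closed walk of faces cuts the vertices into two sides.
  abstract
    jordan : (B : Fin n → Bool) → (∀ d → B (α d) ≡ B d) →
             (∀ h → ϕ-Invariant h → ⨁ (λ d → h d ∧ B d) ≡ false) →
             Σ (Fin n → Bool) λ t → σ-Invariant t × (∀ d → δ t d ≡ B d)
    jordan = TreeCotree.even-is-cut primal (forest id α Face.rep Face.rep-idem (Forest.rest primal))
      where
      primal : Forest id α Vertex.rep edges
      primal = forest id α Vertex.rep Vertex.rep-idem edges

-- Cyclic indices and closed walks of faces

next-fromℕ : ∀ m → next (fromℕ m) ≡ zero
next-fromℕ m = toℕ-injective (trans (toℕ-fromℕ< _)
  (trans (cong (λ k → suc k % suc m) (toℕ-fromℕ m)) (n%n≡0 (suc m))))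

next-inject₁ : ∀ {m} (i : Fin m) → next (inject₁ i) ≡ suc i
next-inject₁ {m} i = toℕ-injective (trans (toℕ-fromℕ< _)
  (trans (cong (λ k → suc k % suc m) (toℕ-inject₁ i)) (m<n⇒m%n≡m (s≤s (toℕ<n i)))))

prev : ∀ {m} → Fin (suc m) → Fin (suc m)
prev {m} zero = fromℕ m
prev (suc i) = inject₁ i

next-prev : ∀ {m} (j : Fin (suc m)) → next (prev j) ≡ j
next-prev {m} zero = next-fromℕ m
next-prev (suc i) = next-inject₁ i

prev-next : ∀ {m} (j : Fin (suc m)) → prev (next j) ≡ j
prev-next j with view j
... | ‵fromℕ {m}  = cong prev (next-fromℕ m)
... | ‵inject₁ i = cong prev (next-inject₁ i)

point : ∀ {n} → Fin n → Fin n → Bool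
point e x = does (x ≟ e)

point-refl : ∀ {n} (e : Fin n) → point e e ≡ true
point-refl e = dec-true (e ≟ e) refl

point-≢ : ∀ {n} {e x : Fin n} → x ≢ e → point e x ≡ false
point-≢ {e = e} {x} = dec-false (x ≟ e)

⨁-∧-point : ∀ {n} (h : Fin n → Bool) e → ⨁ (λ x → h x ∧ point e x) ≡ h e
⨁-∧-point h e = trans
  (⨁-point e _ λ x x≢e → trans (cong (h x ∧_) (point-≢ x≢e)) (∧-zeroʳ (h x)))
  (trans (cong (h e ∧_) (point-refl e)) (∧-identityʳ (h e)))

∧-distribˡ-⨁ : ∀ {n} b (h : Fin n → Bool) → b ∧ ⨁ h ≡ ⨁ (λ x → b ∧ h x)
∧-distribˡ-⨁ true  h = refl
∧-distribˡ-⨁ {n} false h = sym (⨁-zero {n} (λ _ → false) λ _ → refl)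

module BarnetteGraph (G : Map) (o : Fin (Map.n G)) (barnette : Barnette G) where

  private
    involution = proj₁ barnette
    cubic = proj₁ (proj₂ barnette)
    planar = proj₁ (proj₂ (proj₂ (proj₂ barnette)))

  open PlanarMap G involution cubic planar o public

  no-loop : ∀ d → ¬ d ~V α d
  no-loop = proj₁ (proj₁ (proj₂ (proj₂ barnette)))

  no-parallel : ∀ {d e} → d ~V e → α d ~V α e → d ≡ e
  no-parallel = proj₂ (proj₁ (proj₂ (proj₂ barnette))) _ _

  two-vertex-cut-free : ∀ x y → ConnectedOn G (λ d → ¬ d ~V x × ¬ d ~V y)
  two-vertex-cut-free = proj₂ (proj₂ (proj₁ (proj₂ (proj₂ (proj₂ (proj₂ barnette))))))

  edge : Fin n → Fin n → Bool
  edge e x = point e x xor point (α e) x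

  edge-α : ∀ e x → edge e (α x) ≡ edge e x
  edge-α e x = trans (cong₂ _xor_ (point-α e) (trans (point-α (α e)) (cong (λ z → point z x) (α² e))))
                     (xor-comm (point (α e) x) (point e x))
    where
    point-α : ∀ e → point e (α x) ≡ point (α e) x
    point-α e = does-⇔ (mk⇔ (λ eq → trans (sym (α² x)) (cong α eq)) (λ eq → trans (cong α eq) (α² e)))
                       (α x ≟ e) (x ≟ α e)

  edge-refl : ∀ e → edge e e ≡ true
  edge-refl e = cong₂ _xor_ (point-refl e) (point-≢ (α≢ e ∘ sym))

  edge-≢ : ∀ {e x} → x ≢ e → x ≢ α e → edge e x ≡ false
  edge-≢ p q = cong₂ _xor_ (point-≢ p) (point-≢ q)

  abstract
    -- Paired with a face set `h`, the `j`-th crossed edge gives `h (m j) xor h (m (next j))`, and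
    -- these differences cancel around the walk. Edges crossed an even number of times drop out of
    -- the cut.
    closed-walk-cut : ∀ {k} (m : Fin (suc k) → Fin n) → (∀ j → α (m j) ~F m (next j)) →
      Σ (Fin n → Bool) λ t → σ-Invariant t × (∀ d → δ t d ≡ ⨁ (λ j → edge (m j) d))
    closed-walk-cut m walk = jordan (λ d → ⨁ (λ j → edge (m j) d)) (λ d → ⨁-cong λ j → edge-α (m j) d) orthogonal
      where
      orthogonal : ∀ h → ϕ-Invariant h → ⨁ (λ d → h d ∧ ⨁ (λ j → edge (m j) d)) ≡ false
      orthogonal h h-inv =
        trans (⨁-cong λ d → ∧-distribˡ-⨁ (h d) (λ j → edge (m j) d))
        (trans (⨁-comm λ d j → h d ∧ edge (m j) d)
        (trans (⨁-cong λ j → trans (⨁-cong λ d → ∧-distribˡ-xor (h d) (point (m j) d) (point (α (m j)) d))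
          (trans (⨁-distrib-xor (λ d → h d ∧ point (m j) d) (λ d → h d ∧ point (α (m j)) d))
            (cong₂ _xor_ (⨁-∧-point h (m j))
              (trans (⨁-∧-point h (α (m j))) (invariant-orbit ϕ h h-inv (walk j))))))
        (trans (⨁-distrib-xor (h ∘ m) (h ∘ m ∘ next))
          (xor-false (sym (⨁-reindex next prev next-prev prev-next (h ∘ m)))))))

-- Two faces share at most one edge

module ColouredBarnetteGraph (G : Map) (c : Fin (Map.n G) → Color) (o : Fin (Map.n G))
                             (barnette : Barnette G) (colouring : FaceColoring G c) where
  open BarnetteGraph G o barnette public

  cϕ : ϕ-Invariant c
  cϕ = proj₁ colouring

  c~F : ∀ {d e} → d ~F e → c d ≡ c e
  c~F = invariant-orbit ϕ c cϕ

  cα≢ : ∀ d → c (α d) ≢ c d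
  cα≢ = proj₂ colouring

  cα : ∀ d → c (α d) ≡ c (σ d)
  cα = ϕ-inv-α cϕ

  cσ≢ : ∀ d → c (σ d) ≢ c d
  cσ≢ d eq = cα≢ d (trans (cα d) eq)

  cσσ≢ : ∀ d → c (σ (σ d)) ≢ c d
  cσσ≢ d eq = cσ≢ (σ (σ d)) (trans (cong c (σ³ d)) (sym eq))

  -- A cut consisting of two edges x and y of the same colour type would become, after deleting one end of
  -- each on opposite sides, a separation of G by two vertices.
  no-two-edge-cut : (t : Fin n → Bool) → σ-Invariant t → ∀ {x y} → t x ≢ t y →
    (∀ z → z ≢ x → z ≢ y → α z ≢ x → α z ≢ y → t (α z) ≡ t z) →
    c y ≡ c x ⊎ c y ≡ c (α x) → c x ≡ c y ⊎ c x ≡ c (α y) → ⊥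
  no-two-edge-cut t t-inv {x} {y} tx≢ty t-α cy cx = tx≢ty (trans (sym (near-x .proj₁))
    (trans (along (near-x .proj₂) (two-vertex-cut-free x y _ _ (near-x .proj₂) (near-y′))) (near-y .proj₁)))
    where
    t~V : ∀ {d e} → d ~V e → t d ≡ t e
    t~V = invariant-orbit σ t t-inv
    -- The vertex reached from `x` through `σ x` survives the deletion and stays on the side of `x`.
    -- The colour hypothesis ensures that `σ x` is not the edge of `y`, since `α (σ x)` has the
    -- third colour at the vertex of `x`.
    beside : ∀ {x y} → t x ≢ t y → (∀ z → z ≢ x → z ≢ y → α z ≢ x → α z ≢ y → t (α z) ≡ t z) →
             c y ≡ c x ⊎ c y ≡ c (α x) →
             t (α (σ x)) ≡ t x × ¬ α (σ x) ~V x × ¬ α (σ x) ~V y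
    beside {x} {y} tx≢ty t-α cy = tu , not-x , (λ u~y → tx≢ty (trans (sym tu) (t~V u~y)))
      where
      not-x : ¬ α (σ x) ~V x
      not-x u~x = no-loop (σ x) (orbit-trans σ (Vertex.orbit-sym (orbit-step σ)) (Vertex.orbit-sym u~x))
      third : ∀ {k} → k ≡ c x ⊎ k ≡ c (α x) → k ≢ c (σ (σ x))
      third (inj₁ refl) eq = cσσ≢ x (sym eq)
      third (inj₂ refl) eq = cσ≢ (σ x) (trans (sym eq) (cα x))
      tu : t (α (σ x)) ≡ t x
      tu = trans (t-α (σ x) (σ≢ x) (λ eq → tx≢ty (trans (sym (t-inv x)) (cong t eq)))
             (λ eq → not-x (subst (_~V x) (sym eq) (orbit-refl σ)))
             (λ eq → third cy (trans (sym (cong c eq)) (trans (sym (cϕ (α (σ x)))) (cong c (ϕα (σ x))))))) (t-inv x)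
    near-x = beside tx≢ty t-α cy
    near-y = beside (tx≢ty ∘ sym) (λ z a b c′ d → t-α z b a d c′) cx
    near-y′ : ¬ α (σ y) ~V x × ¬ α (σ y) ~V y
    near-y′ = near-y .proj₂ .proj₂ , near-y .proj₂ .proj₁
    along : ∀ {u v} → ¬ u ~V x × ¬ u ~V y →
            Reach G (λ _ → ⊤) (λ d → ¬ d ~V x × ¬ d ~V y) u v → t u ≡ t v
    along _ (here u~v) = t~V u~v
    along {u} (u≁x , u≁y) (step w u~w _ (w≁x , w≁y) rest) = trans (t~V u~w) (trans (sym (t-α w
      (λ { refl → u≁x u~w }) (λ { refl → u≁y u~w })
      (λ eq → w≁x (subst (_~V x) (sym eq) (orbit-refl σ))) (λ eq → w≁y (subst (_~V y) (sym eq) (orbit-refl σ)))))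
      (along (w≁x , w≁y) rest))

  -- `no-two-edge-cut` wants ends on opposite sides. If `d` and `e` lie on the same side, `α e`
  -- takes the place of `e`, because the edge of `e` crosses the cut.
  no-double-edge-cut : ∀ {d e} → d ~F e → α d ~F α e → d ≢ e →
    (t : Fin n → Bool) → σ-Invariant t → (∀ x → δ t x ≡ edge d x xor edge e x) → ⊥
  no-double-edge-cut {d} {e} d~e αd~αe d≢e t t-inv δt = absurd (t d ≟ᵇ t e)
    where
    d≢αe : d ≢ α e
    d≢αe eq = cα≢ e (trans (cong c (sym eq)) (c~F d~e))
    other : ∀ z → z ≢ d → z ≢ e → α z ≢ d → α z ≢ e → t (α z) ≡ t z
    other z p q r s = sym (xor-≡ (trans (δt z) (cong₂ _xor_
      (edge-≢ p (λ eq → r (trans (cong α eq) (α² d)))) (edge-≢ q (λ eq → s (trans (cong α eq) (α² e)))))))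
    αe-jump : t (α e) ≢ t e
    αe-jump eq with () ← trans (sym (xor-false (sym eq))) (trans (δt e) (cong₂ _xor_
      (edge-≢ (d≢e ∘ sym) (λ eq → d≢αe (trans (sym (α² d)) (cong α (sym eq))))) (edge-refl e)))
    absurd : Dec (t d ≡ t e) → ⊥
    absurd (no neq) = no-two-edge-cut t t-inv neq other (inj₁ (sym (c~F d~e))) (inj₁ (c~F d~e))
    absurd (yes eq) = no-two-edge-cut t t-inv {d} {α e} (λ eq′ → αe-jump (trans (sym eq′) eq))
      (λ z p q r s → other z p (λ eq → s (cong α eq)) r (λ eq → q (trans (sym (α² z)) (cong α eq))))
      (inj₂ (sym (c~F αd~αe))) (inj₂ (trans (c~F d~e) (cong c (sym (α² e)))))

  -- Leaving one face through `d` and coming back through `e` is a closed walk of two faces; for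
  -- distinct edges its cut would consist of exactly these two.
  unique-common-edge : ∀ {d e} → d ~F e → α d ~F α e → d ≡ e
  unique-common-edge {d} {e} d~e αd~αe = decide (d ≟ e)
    where
    m : Fin 2 → Fin n
    m zero = d
    m (suc zero) = α e
    walk : ∀ j → α (m j) ~F m (next j)
    walk zero = αd~αe
    walk (suc zero) = subst (_~F d) (sym (α² e)) (Face.orbit-sym d~e)
    decide : Dec (d ≡ e) → d ≡ e
    decide (yes eq) = eq
    decide (no d≢e) = ⊥-elim (no-double-edge-cut d~e αd~αe d≢e (proj₁ cut) (proj₁ (proj₂ cut)) λ x →
      trans (proj₂ (proj₂ cut) x) (cong (edge d x xor_) (trans (xor-identityʳ _)
        (trans (cong (λ z → point (α e) x xor point z x) (α² e)) (xor-comm (point (α e) x) (point e x))))))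
      where cut = closed-walk-cut {1} m walk

-- Bridge from two-colourings to paths, for moves given by functions. A move that is only sometimes
-- allowed is made total by letting it fix the remaining darts.
two-maps-connected : ∀ {n} (f g : Fin n → Fin n) {Base : Rel (Fin n) 0ℓ} →
  (∀ d → EqClosure Base d (f d)) → (∀ d → EqClosure Base d (g d)) → ∀ x y →
  ((t : Fin n → Bool) → (∀ d → t d ≡ t (f d)) → (∀ d → t d ≡ t (g d)) → t x ≡ t y) → EqClosure Base x y
two-maps-connected {n} f g {Base} f⇒R g⇒R x y const =
  cut-connected proj₁ target pairs (EqClosure Base) (EqClosure.isEquivalence Base)
    (λ {e} _ → linked e) x y (λ t eq → const t (λ d → eq (mem (d , true))) (λ d → eq (mem (d , false))))
  where
  target : Fin n × Bool → Fin n
  target (d , b) = if b then f d else g d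
  pairs : List (Fin n × Bool)
  pairs = cartesianProduct (allFin n) (true ∷ false ∷ [])
  linked : ∀ e → EqClosure Base (proj₁ e) (target e)
  linked (d , true)  = f⇒R d
  linked (d , false) = g⇒R d
  mem : ∀ e → e ∈ pairs
  mem (d , true)  = ∈-cartesianProduct⁺ (∈-allFin d) (here refl)
  mem (d , false) = ∈-cartesianProduct⁺ (∈-allFin d) (there (here refl))

_≟ᶜ_ : DecidableEquality Color
c1 ≟ᶜ c1 = yes refl
c1 ≟ᶜ c2 = no λ ()
c1 ≟ᶜ c3 = no λ ()
c2 ≟ᶜ c1 = no λ ()
c2 ≟ᶜ c2 = yes refl
c2 ≟ᶜ c3 = no λ ()
c3 ≟ᶜ c1 = no λ ()
c3 ≟ᶜ c2 = no λ ()
c3 ≟ᶜ c3 = yes refl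

third : Color → Color → Color
third c1 c2 = c3
third c1 c3 = c2
third c2 c1 = c3
third c2 c3 = c1
third c3 c1 = c2
third c3 c2 = c1
third c1 c1 = c1
third c2 c2 = c2
third c3 c3 = c3

third-unique : ∀ a b x → a ≢ b → x ≢ a → x ≢ b → x ≡ third a b
third-unique c1 c1 _  a≢b _ _ = ⊥-elim (a≢b refl)
third-unique c2 c2 _  a≢b _ _ = ⊥-elim (a≢b refl)
third-unique c3 c3 _  a≢b _ _ = ⊥-elim (a≢b refl)
third-unique c1 _  c1 _ x≢a _ = ⊥-elim (x≢a refl)
third-unique c2 _  c2 _ x≢a _ = ⊥-elim (x≢a refl)
third-unique c3 _  c3 _ x≢a _ = ⊥-elim (x≢a refl)
third-unique _  c1 c1 _ _ x≢b = ⊥-elim (x≢b refl)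
third-unique _  c2 c2 _ _ x≢b = ⊥-elim (x≢b refl)
third-unique _  c3 c3 _ _ x≢b = ⊥-elim (x≢b refl)
third-unique c1 c2 c3 _ _ _ = refl
third-unique c1 c3 c2 _ _ _ = refl
third-unique c2 c1 c3 _ _ _ = refl
third-unique c2 c3 c1 _ _ _ = refl
third-unique c3 c1 c2 _ _ _ = refl
third-unique c3 c2 c1 _ _ _ = refl

third-≡ : ∀ {a b x y : Color} → a ≢ b → x ≢ a → x ≢ b → y ≢ a → y ≢ b → x ≡ y
third-≡ a≢b x≢a x≢b y≢a y≢b =
  trans (third-unique _ _ _ a≢b x≢a x≢b) (sym (third-unique _ _ _ a≢b y≢a y≢b))

-- Local structure at vertices and faces, and separations

module HamiltonianSides (G : Map) (c : Fin (Map.n G) → Color) (o : Fin (Map.n G))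
                        (barnette : Barnette G) (colouring : FaceColoring G c) where
  open ColouredBarnetteGraph G c o barnette colouring public

  vertex-cases : ∀ {d e} → d ~V e → e ≡ d ⊎ e ≡ σ d ⊎ e ≡ σ (σ d)
  vertex-cases {d} (k , refl) = go k
    where
    go : ∀ k → iter σ k d ≡ d ⊎ iter σ k d ≡ σ d ⊎ iter σ k d ≡ σ (σ d)
    go zero = inj₁ refl
    go (suc k) with go k
    ... | inj₁ eq = inj₂ (inj₁ (cong σ eq))
    ... | inj₂ (inj₁ eq) = inj₂ (inj₂ (cong σ eq))
    ... | inj₂ (inj₂ eq) = inj₁ (trans (cong σ eq) (σ³ d))

  colour-at-vertex : ∀ k d → ∃[ e ] d ~V e × c e ≡ k
  colour-at-vertex k d with c d ≟ᶜ k | c (σ d) ≟ᶜ k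
  ... | yes eq | _ = d , orbit-refl σ , eq
  ... | no _   | yes eq = σ d , orbit-step σ , eq
  ... | no p   | no q = σ (σ d) , (2 , refl) , third-≡ (cσ≢ d ∘ sym) (cσσ≢ d) (cσ≢ (σ d)) (p ∘ sym) (q ∘ sym)

  ~V-colour-unique : ∀ {d e} → d ~V e → c d ≡ c e → d ≡ e
  ~V-colour-unique {d} d~e cd≡ce with vertex-cases d~e
  ... | inj₁ eq = sym eq
  ... | inj₂ (inj₁ eq) = ⊥-elim (cσ≢ d (trans (cong c (sym eq)) (sym cd≡ce)))
  ... | inj₂ (inj₂ eq) = ⊥-elim (cσσ≢ d (trans (cong c (sym eq)) (sym cd≡ce)))

  α~σ : ∀ d → α d ~F σ d
  α~σ d = 1 , ϕα d

  -- Any two of the three darts at a cubic vertex are consecutive under `σ`.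
  common-edge : ∀ {d e} → d ~V e → c d ≢ c e → ∃[ m ] m ~F d × α m ~F e
  common-edge {d} d~e cd≢ce with vertex-cases d~e
  ... | inj₁ refl = ⊥-elim (cd≢ce refl)
  ... | inj₂ (inj₁ refl) = d , orbit-refl ϕ , α~σ d
  ... | inj₂ (inj₂ refl) = α (σ (σ d)) , subst (α (σ (σ d)) ~F_) (σ³ d) (α~σ (σ (σ d))) ,
        subst (_~F σ (σ d)) (sym (α² _)) (orbit-refl ϕ)

  -- The faces across consecutive edges of a face are adjacent to each other and to that face, so
  -- their colours alternate between the other two.
  cαϕϕ : ∀ d → c (α (ϕ (ϕ d))) ≡ c (α d)
  cαϕϕ d = third-≡ (λ eq → cα≢ (ϕ d) (sym (trans (cϕ d) eq)))
    (λ eq → cα≢ (ϕ (ϕ d)) (trans eq (trans (sym (cϕ d)) (sym (cϕ (ϕ d))))))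
    (cαϕ≢ (ϕ d)) (cα≢ d) (cαϕ≢ d ∘ sym)
    where
    cαϕ≢ : ∀ d → c (α (ϕ d)) ≢ c (α d)
    cαϕ≢ d eq = cσσ≢ (α d) (trans (sym (cα (ϕ d))) eq)

  no-digon : ∀ d → ϕ (ϕ d) ≢ d
  no-digon d eq = σ≢ (ϕ d) (sym (cong σ (trans (cong α d≡αϕd) (α² (ϕ d)))))
    where
    d≡αϕd : d ≡ α (ϕ d)
    d≡αϕd = no-parallel (Vertex.orbit-sym (1 , eq)) (subst (α d ~V_) (sym (α² (ϕ d))) (orbit-step σ))

  -- The sides of a hamiltonian cycle C having all i-faces on one side (true) and all j-faces on the other.
  -- C consists of the edges whose two faces lie on different sides; such an edge set always has degree 2
  -- at every vertex, so only its connectedness remains, expressed by two-colourings.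
  record Separation (i j : Color) : Set where
    field
      side      : Fin n → Bool
      side-ϕ    : ϕ-Invariant side
      side-i    : ∀ {d} → c d ≡ i → side d ≡ true
      side-j    : ∀ {d} → c d ≡ j → side d ≡ false
      connected : (t : Fin n → Bool) → σ-Invariant t → (∀ d → side d ≢ side (α d) → t (α d) ≡ t d) →
                  ∀ x y → t x ≡ t y

    side~F : ∀ {d e} → d ~F e → side d ≡ side e
    side~F = invariant-orbit ϕ side side-ϕ

  opposite : ∀ {i j} → Separation i j → Separation j i
  opposite S = record
    { side = not ∘ side ; side-ϕ = cong not ∘ side-ϕ
    ; side-i = cong not ∘ side-j ; side-j = cong not ∘ side-i
    ; connected = λ t t-inv t-α → connected t t-inv λ d s≢ → t-α d (s≢ ∘ not-injective)
    }
    where open Separation S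

  -- The radial graph as a graph of faces of G

  module SpanningTree {i j : Color} (i≢j : i ≢ j) (c1≢i : c1 ≢ i) (c1≢j : c1 ≢ j) where

    colour-cases : ∀ k → k ≡ c1 ⊎ k ≡ i ⊎ k ≡ j
    colour-cases k with k ≟ᶜ c1 | k ≟ᶜ i
    ... | yes p | _     = inj₁ p
    ... | no _  | yes q = inj₂ (inj₁ q)
    ... | no p  | no q  = inj₂ (inj₂ (third-≡ c1≢i p q (c1≢j ∘ sym) (i≢j ∘ sym)))

    Node : Set
    Node = Fin n ⊎ Fin n

    dart : Node → Fin n
    dart (inj₁ x) = x
    dart (inj₂ f) = f

    module Radial (inT : Fin n → Bool) (inT⇒c1 : ∀ {d} → inT d ≡ true → c d ≡ c1)
                  (inT-ϕ : ϕ-Invariant inT) where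

      Valid : Node → Set
      Valid = RValid G c i inT

      Same Adj : Node → Node → Set
      Same = RSame G c i
      Adj = RAdj G c i

      RPath : Node → Node → Set
      RPath = Path Valid Same Adj

      same⇒~F : ∀ a b → Same a b → dart a ~F dart b
      same⇒~F (inj₁ _) (inj₁ _) s = s
      same⇒~F (inj₂ _) (inj₂ _) s = s

      ~F⇒same : ∀ {a b} → Valid a → Valid b → dart a ~F dart b → Same a b
      ~F⇒same {inj₁ _} {inj₁ _} _ _ s = s
      ~F⇒same {inj₂ _} {inj₂ _} _ _ s = s
      ~F⇒same {inj₁ _} {inj₂ _} va vb s = ⊥-elim (c1≢i (trans (sym (inT⇒c1 vb)) (trans (sym (c~F s)) va)))
      ~F⇒same {inj₂ _} {inj₁ _} va vb s = ⊥-elim (c1≢i (trans (sym (inT⇒c1 va)) (trans (c~F s) vb)))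

      -- With `adj⇒edge`, radial adjacency becomes sharing an edge of G. Nodes of the same kind have
      -- the same colour and never share one.
      edge⇒adj : ∀ {a b m} → Valid a → Valid b → m ~F dart a → α m ~F dart b → Adj a b
      edge⇒adj {inj₁ _} {inj₁ _} {m} va vb ma mb =
        ⊥-elim (cα≢ m (trans (c~F mb) (trans vb (sym (trans (c~F ma) va)))))
      edge⇒adj {inj₂ _} {inj₂ _} {m} va vb ma mb =
        ⊥-elim (cα≢ m (trans (c~F mb) (trans (inT⇒c1 vb) (sym (trans (c~F ma) (inT⇒c1 va))))))
      edge⇒adj {inj₁ _} {inj₂ _} {m} va vb ma mb =
        σ m , orbit-trans ϕ (Face.orbit-sym (α~σ m)) mb , m , Vertex.orbit-sym (orbit-step σ) , ma
      edge⇒adj {inj₂ _} {inj₁ _} {m} va vb ma mb =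
        m , ma , σ m , orbit-step σ , orbit-trans ϕ (Face.orbit-sym (α~σ m)) mb

      adj⇒edge : ∀ a b → Valid a → Valid b → Adj a b → ∃[ m ] m ~F dart a × α m ~F dart b
      adj⇒edge (inj₁ X) (inj₂ f) va vb (d , d~f , e , d~e , e~X)
        with m , m~e , αm~d ← common-edge (Vertex.orbit-sym d~e)
               (λ eq → c1≢i (trans (sym (inT⇒c1 vb)) (trans (sym (c~F d~f)) (trans (sym eq) (trans (c~F e~X) va))))) =
        m , orbit-trans ϕ m~e e~X , orbit-trans ϕ αm~d d~f
      adj⇒edge (inj₂ f) (inj₁ X) va vb (d , d~f , e , d~e , e~X)
        with m , m~d , αm~e ← common-edge d~e
               (λ eq → c1≢i (trans (sym (inT⇒c1 va)) (trans (sym (c~F d~f)) (trans eq (trans (c~F e~X) vb))))) =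
        m , orbit-trans ϕ m~d d~f , orbit-trans ϕ αm~e e~X

      inside : Fin n → Bool
      inside d = does (c d ≟ᶜ i) ∨ inT d

      inside-ϕ : ϕ-Invariant inside
      inside-ϕ d = cong₂ _∨_ (cong (λ k → does (k ≟ᶜ i)) (cϕ d)) (inT-ϕ d)

      inside~F : ∀ {d e} → d ~F e → inside d ≡ inside e
      inside~F = invariant-orbit ϕ inside inside-ϕ

      inside-i : ∀ {d} → c d ≡ i → inside d ≡ true
      inside-i {d} cd = cong (_∨ inT d) (dec-true (c d ≟ᶜ i) cd)

      inside-j : ∀ {d} → c d ≡ j → inside d ≡ false
      inside-j {d} cd = cong₂ _∨_ (dec-false (c d ≟ᶜ i) (λ p → i≢j (trans (sym p) cd)))
        (¬-not λ p → c1≢j (trans (sym (inT⇒c1 p)) cd))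

      valid⇒inside : ∀ a → Valid a → inside (dart a) ≡ true
      valid⇒inside (inj₁ X) v = inside-i v
      valid⇒inside (inj₂ f) v = trans (cong (does (c f ≟ᶜ i) ∨_) v) (∨-zeroʳ _)

      nodeOf : ∀ d → Dec (c d ≡ i) → Node
      nodeOf d (yes _) = inj₁ d
      nodeOf d (no _)  = inj₂ d

      node : Fin n → Node
      node d = nodeOf d (c d ≟ᶜ i)

      dart-node : ∀ d → dart (node d) ≡ d
      dart-node d with c d ≟ᶜ i
      ... | yes _ = refl
      ... | no _  = refl

      node-valid : ∀ {d} → inside d ≡ true → Valid (node d)
      node-valid {d} ins with c d ≟ᶜ i
      ... | yes p = p
      ... | no _  = ins

      -- `Path` allows a change of representative only at its last node; at the first node the
      -- initial adjacency is re-derived through a common edge.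
      prepend-same : ∀ {a a′ b} → Valid a → Valid a′ → Same a a′ → Valid b → RPath a′ b → RPath a b
      prepend-same {a} {a′} {b} va va′ s vb (here s′) =
        here (~F⇒same va vb (orbit-trans ϕ (same⇒~F a a′ s) (same⇒~F a′ b s′)))
      prepend-same {a} {a′} va va′ s vb (step x adj vx p)
        with m , m~a′ , αm~x ← adj⇒edge a′ x va′ vx adj =
        step x (edge⇒adj va vx (orbit-trans ϕ m~a′ (Face.orbit-sym (same⇒~F a a′ s))) αm~x) vx p

    -- From a separation to a spanning tree of 1-faces

    module SeparationToTree (S : Separation i j) where
      open Separation S

      inT : Fin n → Bool
      inT d = side d ∧ does (c d ≟ᶜ c1)

      inT⇒side : ∀ {d} → inT d ≡ true → side d ≡ true
      inT⇒side {d} = ∧-conicalˡ (side d) _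

      inT⇒c1 : ∀ {d} → inT d ≡ true → c d ≡ c1
      inT⇒c1 {d} eq = does-true (c d ≟ᶜ c1) (∧-conicalʳ (side d) _ eq)

      inT-ϕ : ϕ-Invariant inT
      inT-ϕ d = cong₂ (λ b k → b ∧ does (k ≟ᶜ c1)) (side-ϕ d) (cϕ d)

      open Radial inT inT⇒c1 inT-ϕ

      side-true-cases : ∀ {d} → side d ≡ true → c d ≡ i ⊎ inT d ≡ true
      side-true-cases {d} s with colour-cases (c d)
      ... | inj₁ cd = inj₂ (cong₂ _∧_ s (dec-true (c d ≟ᶜ c1) cd))
      ... | inj₂ (inj₁ cd) = inj₁ cd
      ... | inj₂ (inj₂ cd) with () ← trans (sym s) (side-j cd)

      valid⇒side : ∀ a → Valid a → side (dart a) ≡ true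
      valid⇒side (inj₁ X) v = side-i v
      valid⇒side (inj₂ f) v = inT⇒side v

      valid-node : ∀ {d} → side d ≡ true → ∃[ a ] Valid a × dart a ≡ d
      valid-node {d} s = [ (λ cd → inj₁ d , cd , refl) , (λ t → inj₂ d , t , refl) ]′ (side-true-cases s)

      data Neighbours : Fin n → Fin n → Set where
        along  : ∀ d → Neighbours d (ϕ d)
        across : ∀ d → side d ≡ true → side (α d) ≡ true → Neighbours d (α d)

      neighbours⇒path : ∀ {x y} → EqClosure Neighbours x y → ∀ a b → Valid a → Valid b →
                        dart a ≡ x → dart b ≡ y → RPath a b
      neighbours⇒path ε a b va vb refl eq = here (~F⇒same va vb (0 , sym eq))
      neighbours⇒path (fwd (along d) ◅ steps) a b va vb refl eq
        with a′ , va′ , eq′ ← valid-node (trans (side-ϕ d) (valid⇒side a va)) =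
        prepend-same va va′ (~F⇒same va va′ (1 , sym eq′)) vb (neighbours⇒path steps a′ b va′ vb eq′ eq)
      neighbours⇒path (bwd (along d) ◅ steps) a b va vb eqa eq
        with a′ , va′ , refl ← valid-node (trans (sym (side-ϕ d)) (trans (cong side (sym eqa)) (valid⇒side a va))) =
        prepend-same va va′ (~F⇒same va va′ (Face.orbit-sym (1 , sym eqa))) vb
          (neighbours⇒path steps a′ b va′ vb refl eq)
      neighbours⇒path (fwd (across d s sα) ◅ steps) a b va vb refl eq with a′ , va′ , eq′ ← valid-node sα =
        step a′ (edge⇒adj va va′ (orbit-refl ϕ) (0 , sym eq′)) va′ (neighbours⇒path steps a′ b va′ vb eq′ eq)
      neighbours⇒path (bwd (across d s sα) ◅ steps) a b va vb eqa eq with a′ , va′ , refl ← valid-node s =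
        step a′ (edge⇒adj {m = α d} va va′ (0 , sym eqa) (0 , α² _)) va′ (neighbours⇒path steps a′ b va′ vb refl eq)

      -- A two-colouring h of the inside faces that is constant across edges off C colours every vertex by
      -- the inside faces around it; edges of C preserve this colour since they border an inside face.
      inside-constant : (h : Fin n → Bool) → ϕ-Invariant h →
        (∀ d → side d ≡ true → side (α d) ≡ true → h d ≡ h (α d)) →
        ∀ {x y} → side x ≡ true → side y ≡ true → h x ≡ h y
      inside-constant h h-ϕ h-α {x} {y} sx sy =
        trans (h≡t sx) (trans (connected t t-inv t-C x y) (sym (h≡t sy)))
        where
        i-dart : ∀ d → ∃[ e ] d ~V e × c e ≡ i
        i-dart = colour-at-vertex i
        t : Fin n → Bool
        t d = h (proj₁ (i-dart d))
        t-inv : σ-Invariant t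
        t-inv d = cong h (~V-colour-unique
          (orbit-trans σ (Vertex.orbit-sym (proj₁ (proj₂ (i-dart (σ d)))))
            (orbit-trans σ (Vertex.orbit-sym (orbit-step σ)) (proj₁ (proj₂ (i-dart d)))))
          (trans (proj₂ (proj₂ (i-dart (σ d)))) (sym (proj₂ (proj₂ (i-dart d))))))
        h~F : ∀ {d e} → d ~F e → h d ≡ h e
        h~F = invariant-orbit ϕ h h-ϕ
        h≡t : ∀ {d} → side d ≡ true → h d ≡ t d
        h≡t {d} s with i-dart d
        ... | e , d~e , ce with c d ≟ᶜ c e
        ...   | yes eq = cong h (~V-colour-unique d~e eq)
        ...   | no neq with m , m~d , αm~e ← common-edge d~e neq =
          trans (sym (h~F m~d)) (trans (h-α m (trans (side~F m~d) s)
            (trans (side~F αm~e) (side-i ce))) (h~F αm~e))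
        t-C : ∀ d → side d ≢ side (α d) → t (α d) ≡ t d
        t-C d s≢ with side d in s | side (α d) in sα
        ... | true  | true  = ⊥-elim (s≢ refl)
        ... | false | false = ⊥-elim (s≢ refl)
        ... | true  | false = trans (sym (t-inv (α d)))
          (trans (sym (h≡t (trans (side-ϕ d) s))) (trans (h-ϕ d) (h≡t s)))
        ... | false | true  = trans (sym (h≡t sα)) (trans (ϕ-inv-α h-ϕ d)
          (trans (h≡t (trans (sym (ϕ-inv-α side-ϕ d)) sα)) (t-inv d)))

      tree-connected : GConnected Valid Same Adj
      tree-connected a b va vb = neighbours⇒path
        (two-maps-connected ϕ crossing (λ d → return (fwd (along d))) crossing-step (dart a) (dart b)
          λ t t-ϕ t-crossing → inside-constant t (sym ∘ t-ϕ)
            (λ d s sα → trans (t-crossing d) (cong t (crosses d s sα))) (valid⇒side a va) (valid⇒side b vb))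
        a b va vb refl refl
        where
        -- Darts whose edge does not have both sides inside stay where they are.
        crossing : Fin n → Fin n
        crossing d = if side d ∧ side (α d) then α d else d
        crosses : ∀ d → side d ≡ true → side (α d) ≡ true → crossing d ≡ α d
        crosses d s sα = cong (λ b → if b then α d else d) (cong₂ _∧_ s sα)
        crossing-step : ∀ d → EqClosure Neighbours d (crossing d)
        crossing-step d with side d in s | side (α d) in sα
        ... | true  | true  = return (fwd (across d s sα))
        ... | true  | false = ε
        ... | false | _     = ε

      -- Otherwise C would be the boundary of X, and a 1-face would meet X in two edges.
      another-i-face : ∀ {X} → c X ≡ i → ∃[ X′ ] c X′ ≡ i × ¬ X ~F X′
      another-i-face {X} cX with e , X~e , ce ← colour-at-vertex c1 X
        with m , m~e , αm~X ← common-edge (Vertex.orbit-sym X~e) (λ eq → c1≢i (trans (sym ce) (trans eq cX))) =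
        α (ϕ (ϕ m)) , trans (cαϕϕ m) (trans (c~F αm~X) cX) ,
        λ X~X′ → no-digon m (sym (unique-common-edge (2 , refl) (orbit-trans ϕ αm~X X~X′)))

      -- This gives the covering condition: a path to a second i-face has to leave `X` through a
      -- face of the tree.
      leaves : ∀ {X X′} → ¬ X ~F X′ → RPath (inj₁ X) (inj₁ X′) → ∃[ f ] inT f ≡ true × VertexOnFace G c i X f
      leaves X≁X′ (here s) = ⊥-elim (X≁X′ s)
      leaves X≁X′ (step (inj₂ f) adj vf _) = f , vf , adj

      tree-covers : ∀ X → c X ≡ i → ∃[ f ] inT f ≡ true × VertexOnFace G c i X f
      tree-covers X cX =
        let X′ , cX′ , X≁X′ = another-i-face cX in leaves X≁X′ (tree-connected (inj₁ X) (inj₁ X′) cX cX′)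

      -- All crossed edges have both sides inside, so the cut misses C and is constant; yet it
      -- contains the edge of `m zero`, which by `only-once` does not cancel.
      acyclic : ¬ GCycle Valid Same Adj
      acyclic (k , w , valid , distinct , adjacent) = contradict (closed-walk-cut m walk)
        where
        link : ∀ l → ∃[ m ] m ~F dart (w l) × α m ~F dart (w (next l))
        link l = adj⇒edge (w l) (w (next l)) (valid l) (valid (next l)) (adjacent l)
        m : Fin (3 + k) → Fin n
        m l = proj₁ (link l)
        m~ : ∀ l → m l ~F dart (w l)
        m~ l = proj₁ (proj₂ (link l))
        αm~ : ∀ l → α (m l) ~F dart (w (next l))
        αm~ l = proj₂ (proj₂ (link l))
        walk : ∀ l → α (m l) ~F m (next l)
        walk l = orbit-trans ϕ (αm~ l) (Face.orbit-sym (m~ (next l)))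
        separate : ∀ {l l′} → l ≢ l′ → ¬ dart (w l) ~F dart (w l′)
        separate {l} {l′} l≢l′ s = distinct l l′ l≢l′ (~F⇒same (valid l) (valid l′) s)
        m-inside : ∀ l → side (m l) ≡ true × side (α (m l)) ≡ true
        m-inside l = trans (side~F (m~ l)) (valid⇒side (w l) (valid l)) ,
                     trans (side~F (αm~ l)) (valid⇒side (w (next l)) (valid (next l)))
        only-once : ∀ l → l ≢ zero → edge (m l) (m zero) ≡ false
        only-once l l≢0 = edge-≢
          (λ eq → separate (l≢0 ∘ sym) (orbit-trans ϕ (Face.orbit-sym (m~ zero)) (subst (_~F dart (w l)) (sym eq) (m~ l))))
          (λ eq → reversed eq (next l ≟ zero))
          where
          reversed : m zero ≡ α (m l) → Dec (next l ≡ zero) → ⊥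
          reversed eq (no ≢0) = separate (≢0 ∘ sym)
            (orbit-trans ϕ (Face.orbit-sym (m~ zero)) (subst (_~F dart (w (next l))) (sym eq) (αm~ l)))
          -- Crossing the same edge backwards forces `l` to be `next zero` and its successor `zero`,
          -- impossible with at least three nodes.
          reversed eq (yes ≡0) = separate (λ l≡ → next²0 (trans (cong next l≡) ≡0))
            (orbit-trans ϕ (Face.orbit-sym (αm~ zero))
              (subst (_~F dart (w l)) (sym (trans (cong α eq) (α² (m l)))) (m~ l)))
            where
            next²0 : next (next (zero {2 + k})) ≢ zero
            next²0 eq with () ← trans (sym (next-inject₁ (suc (zero {k}))))
                                      (trans (sym (cong next (next-inject₁ (zero {suc k})))) eq)
        t-C : (t : Fin n → Bool) → (∀ d → δ t d ≡ ⨁ (λ l → edge (m l) d)) →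
              ∀ d → side d ≢ side (α d) → t (α d) ≡ t d
        t-C t t-cut d s≢ = sym (xor-≡ (trans (t-cut d) (⨁-zero (λ l → edge (m l) d) λ l → edge-≢ {m l} {d}
          (λ { refl → s≢ (trans (proj₁ (m-inside l)) (sym (proj₂ (m-inside l)))) })
          (λ { refl → s≢ (trans (proj₂ (m-inside l)) (sym (trans (cong side (α² (m l))) (proj₁ (m-inside l))))) }))))
        contradict : (Σ (Fin n → Bool) λ t → σ-Invariant t × (∀ d → δ t d ≡ ⨁ (λ l → edge (m l) d))) → ⊥
        contradict (t , t-inv , t-cut) with () ← trans (sym (xor-false (connected t t-inv (t-C t t-cut) (m zero) (α (m zero)))))
            (trans (t-cut (m zero)) (trans (⨁-point zero (λ l → edge (m l) (m zero)) only-once) (edge-refl (m zero))))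

      spanningTree : c o ≢ c1 → HasSpanningTreeOf1Faces G c i o
      spanningTree co≢c1 = inT , inT-ϕ ,
        (λ d t → (λ cd → c1≢i (trans (sym (inT⇒c1 t)) cd)) ,
                 (λ d~o → co≢c1 (trans (sym (c~F d~o)) (inT⇒c1 t))) , inT⇒c1 t) ,
        (λ d _ t tα → ⊥-elim (cα≢ d (trans (inT⇒c1 tα) (sym (inT⇒c1 t))))) ,
        tree-covers , tree-connected , acyclic

    -- From a spanning tree of 1-faces to a separation

    module TreeToSeparation (inT : Fin n → Bool) (spanning : SpanningTreeOf1Faces G c i o inT) where

      open Radial inT (λ {d} eq → proj₂ (proj₂ (proj₁ (proj₂ spanning) d eq))) (proj₁ spanning)

      private
        tree-connected : GConnected Valid Same Adj
        tree-connected = proj₁ (proj₂ (proj₂ (proj₂ (proj₂ spanning))))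

        acyclic : ¬ GCycle Valid Same Adj
        acyclic = proj₂ (proj₂ (proj₂ (proj₂ (proj₂ spanning))))

      -- A walk through the faces of the tree that never turns back would eventually close up to a cycle.
      module Walk (x : ℕ → Fin n) (x-inside : ∀ k → inside (x k) ≡ true)
                  (x-next : ∀ k → α (x k) ~F x (suc k)) (no-return : ∀ k → x (suc k) ≢ α (x k)) where

        FirstRepetition : ℕ → ℕ → Set
        FirstRepetition a b = x a ~F x b × (∀ p q → p < q → q < b → ¬ x p ~F x q)

        -- The repetition closes up `suc l` faces. One face would be its own neighbour, against the
        -- colouring; two would share two edges unless the walk turned back; three or more form a
        -- `GCycle`.
        no-repetition : ∀ l a → ¬ FirstRepetition a (suc l + a)
        no-repetition zero a (rep , _) = cα≢ (x a) (trans (c~F (x-next a)) (sym (c~F rep)))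
        no-repetition (suc zero) a (rep , _) = no-return a (trans (sym (α² _)) (cong α (sym (unique-common-edge
          (orbit-trans ϕ rep (Face.orbit-sym (x-next (suc a))))
          (subst (α (x a) ~F_) (sym (α² (x (suc a)))) (x-next a))))))
        no-repetition (suc (suc k)) a (rep , first) = acyclic (k , w , valid , distinct , adjacent)
          where
          place : Fin (3 + k) → Fin n
          place l = x (toℕ l + a)
          w : Fin (3 + k) → Node
          w l = node (place l)
          valid : ∀ l → Valid (w l)
          valid l = node-valid (x-inside (toℕ l + a))
          w~ : ∀ l → dart (w l) ≡ place l
          w~ l = dart-node (place l)
          apart : ∀ l l′ → toℕ l < toℕ l′ → ¬ place l ~F place l′
          apart l l′ lt = first _ _ (ℕ.+-monoˡ-< a lt) (ℕ.+-monoˡ-< a (toℕ<n l′))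
          distinct : ∀ l l′ → l ≢ l′ → ¬ Same (w l) (w l′)
          distinct l l′ l≢l′ s with same ← subst₂ _~F_ (w~ l) (w~ l′) (same⇒~F (w l) (w l′) s)
                                  | ℕ.<-cmp (toℕ l) (toℕ l′)
          ... | tri< lt _ _ = apart l l′ lt same
          ... | tri≈ _ eq _ = l≢l′ (toℕ-injective eq)
          ... | tri> _ _ gt = apart l′ l gt (Face.orbit-sym same)
          onward : ∀ l → α (place l) ~F place (next l)
          onward l with view l
          ... | ‵fromℕ = subst₂ (λ p q → α (x (p + a)) ~F x (toℕ q + a)) (sym (toℕ-fromℕ (2 + k)))
              (sym (next-fromℕ (2 + k))) (orbit-trans ϕ (x-next _) (Face.orbit-sym rep))
          ... | ‵inject₁ l′ = subst₂ (λ p q → α (x (p + a)) ~F x (toℕ q + a)) (sym (toℕ-inject₁ l′))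
              (sym (next-inject₁ l′)) (x-next _)
          adjacent : ∀ l → Adj (w l) (w (next l))
          adjacent l = edge⇒adj (valid l) (valid (next l)) (0 , sym (w~ l))
            (subst (α (place l) ~F_) (sym (w~ (next l))) (onward l))

        Repeats : Fin (suc n) → Set
        Repeats b = ∃[ a ] toℕ {suc n} a < toℕ b × x (toℕ a) ~F x (toℕ b)

        repeats? : Decidable Repeats
        repeats? b = any? λ a → (toℕ a ℕ.<? toℕ b) ×-dec Face.orbit? (x (toℕ a)) (x (toℕ b))

        some-repetition : ∃ Repeats
        some-repetition = let i , j , i<j , eq = pigeonhole {n} {suc n} ℕ.≤-refl (x ∘ toℕ) in
          j , i , i<j , 0 , eq

        first : ∀ (b : Fin (suc n)) → (∀ j → Repeats j → toℕ b ≤ toℕ j) →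
                ∀ p q → p < q → q < toℕ b → ¬ x p ~F x q
        first b minimal p q p<q q<b same = ℕ.<⇒≱ q<b (subst (toℕ b ≤_) (toℕ-fromℕ< q<n) (minimal (fromℕ< q<n)
          (fromℕ< p<n , subst₂ _<_ (sym (toℕ-fromℕ< p<n)) (sym (toℕ-fromℕ< q<n)) p<q ,
           subst₂ (λ k k′ → x k ~F x k′) (sym (toℕ-fromℕ< p<n)) (sym (toℕ-fromℕ< q<n)) same)))
          where
          q<n : q < suc n
          q<n = ℕ.<-trans q<b (toℕ<n b)
          p<n : p < suc n
          p<n = ℕ.<-trans p<q q<n

        first-repetition : ∃[ l ] ∃[ a ] FirstRepetition a (suc l + a)
        first-repetition = let b , (a , a<b , rep) , minimal = least repeats? some-repetition in
          toℕ b ∸ suc (toℕ a) , toℕ a ,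
          subst (FirstRepetition (toℕ a)) (sym (trans (sym (ℕ.+-suc _ (toℕ a))) (ℕ.m∸n+n≡m a<b)))
            (rep , first b minimal)

        impossible : ⊥
        impossible = let l , a , rep = first-repetition in no-repetition l a rep

      module Cut (t : Fin n → Bool) (t-inv : σ-Invariant t)
                 (t-C : ∀ d → inside d ≢ inside (α d) → t (α d) ≡ t d) where

        t-ϕ : ∀ d → t (ϕ d) ≡ t (α d)
        t-ϕ d = t-inv (α d)

        Cutting : Set
        Cutting = ∃[ d ] inside d ≡ true × δ t d ≡ true

        jump : ∀ {d} → δ t d ≡ true → t (α d) ≢ t d
        jump δd eq with () ← trans (sym (xor-false (sym eq))) δd

        -- A cut edge is not on C, so both its faces are on the same side. This keeps the walk
        -- across cut edges inside.
        cutting-α : ∀ {d} → inside d ≡ true → δ t d ≡ true → inside (α d) ≡ true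
        cutting-α {d} ins δd = decide (inside d ≟ᵇ inside (α d))
          where
          decide : Dec (inside d ≡ inside (α d)) → inside (α d) ≡ true
          decide (yes eq) = trans (sym eq) ins
          decide (no neq) = ⊥-elim (jump δd (t-C d neq))

        -- t changes an even number of times around a face.
        another-cut : ∀ y → δ t y ≡ true → ∃[ z ] y ~F z × δ t z ≡ true × z ≢ y
        another-cut y δy with p , _ , eq ← Face.period y = conclude {p} eq (search p)
          where
          -- The last clause is what distinguishes `z` from `y`: at the first change after `y` the
          -- value of `t` is still that of `ϕ y`, whereas `t y` differs from it.
          Found : Set
          Found = ∃[ z ] y ~F z × δ t z ≡ true × t z ≡ t (ϕ y)
          search : ∀ q → Found ⊎ t (iter ϕ (suc q) y) ≡ t (ϕ y)
          search zero = inj₂ refl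
          search (suc q) with search q
          ... | inj₁ found = inj₁ found
          ... | inj₂ eq with δ t (iter ϕ (suc q) y) in δz
          ...   | true  = inj₁ (iter ϕ (suc q) y , (suc q , refl) , δz , eq)
          ...   | false = inj₂ (trans (t-ϕ (iter ϕ (suc q) y)) (trans (sym (xor-≡ δz)) eq))
          conclude : ∀ {p} → iter ϕ (suc p) y ≡ y → Found ⊎ t (iter ϕ (suc p) y) ≡ t (ϕ y) →
                     ∃[ z ] y ~F z × δ t z ≡ true × z ≢ y
          conclude _ (inj₁ (z , y~z , δz , tz)) =
            z , y~z , δz , λ z≡y → jump δy (trans (sym (t-ϕ y)) (trans (sym tz) (cong t z≡y)))
          conclude eq (inj₂ same) = ⊥-elim (jump δy (trans (sym (t-ϕ y)) (trans (sym same) (cong t eq))))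

        module Trail (start : Cutting) where

          advance : ((d , _) : Cutting) → ∃[ z ] α d ~F z × δ t z ≡ true × z ≢ α d
          advance (d , _ , δd) = another-cut (α d) (trans (δ-α t d) δd)

          cut : ℕ → Cutting
          cut zero = start
          cut (suc k) = let z , αd~z , δz , _ = advance (cut k) ; d , ins , δd = cut k in
            z , trans (sym (inside~F αd~z)) (cutting-α ins δd) , δz

          x : ℕ → Fin n
          x k = proj₁ (cut k)

          impossible : ⊥
          impossible = Walk.impossible x (λ k → proj₁ (proj₂ (cut k)))
            (λ k → proj₁ (proj₂ (advance (cut k)))) (λ k → proj₂ (proj₂ (proj₂ (advance (cut k)))))

        inside-uncut : ∀ {d} → inside d ≡ true → t d ≡ t (α d)
        inside-uncut {d} ins with δ t d in δd
        ... | false = xor-≡ δd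
        ... | true  = ⊥-elim (Trail.impossible (d , ins , δd))

        t~F : ∀ {d e} → inside d ≡ true → d ~F e → t d ≡ t e
        t~F {d} ins (k , refl) = go k
          where
          go : ∀ k → t d ≡ t (iter ϕ k d)
          go zero = refl
          go (suc k) = trans (go k) (trans (inside-uncut (trans (invariant-iter ϕ inside inside-ϕ k d) ins))
                                           (sym (t-ϕ (iter ϕ k d))))

        path-constant : ∀ a b → Valid a → RPath a b → t (dart a) ≡ t (dart b)
        path-constant a b va (here s) = t~F (valid⇒inside a va) (same⇒~F a b s)
        path-constant a b va (step x adj vx p) with m , m~a , αm~x ← adj⇒edge a x va vx adj =
          trans (t~F (valid⇒inside a va) (Face.orbit-sym m~a))
            (trans (inside-uncut (trans (inside~F m~a) (valid⇒inside a va)))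
              (trans (t~F (trans (inside~F αm~x) (valid⇒inside x vx)) αm~x) (path-constant x b vx p)))

        -- Every vertex lies on an i-face, and the tree joins the i-faces through uncut edges.
        constant : ∀ x y → t x ≡ t y
        constant x y with d , x~d , cd ← colour-at-vertex i x | e , y~e , ce ← colour-at-vertex i y =
          trans (t~V x~d) (trans (path-constant (inj₁ d) (inj₁ e) cd (tree-connected (inj₁ d) (inj₁ e) cd ce))
                                 (sym (t~V y~e)))
          where
          t~V : ∀ {d e} → d ~V e → t d ≡ t e
          t~V = invariant-orbit σ t t-inv

      separation : Separation i j
      separation = record
        { side = inside ; side-ϕ = inside-ϕ ; side-i = inside-i ; side-j = inside-j
        ; connected = λ t t-inv t-C → Cut.constant t t-inv t-C }

module Equivalences (G : Map) (c : Fin (Map.n G) → Color) (o : Fin (Map.n G))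
                    (barnette : Barnette G) (colouring : FaceColoring G c) where
  open HamiltonianSides G c o barnette colouring public

  hamiltonCycle⇒separation : HamCycle2In3Out G c o → Separation c2 c3
  hamiltonCycle⇒separation (inC , (_ , _ , reach) , s , (s-ϕ , s-C , _) , s-2 , s-3) = record
    { side = s ; side-ϕ = s-ϕ ; side-i = s-2 _ ; side-j = s-3 _
    ; connected = λ t t-inv t-C x y → reach-invariant t t-inv (λ w w∈C → t-C w λ eq →
        true≢false (trans (sym w∈C) (Equivalence.to (s-C w) (sym eq)))) (reach x y)
    }
    where
    true≢false : true ≢ false
    true≢false ()

  -- An edge between a 2-face and a 3-face is oriented so that its dart lies on the 3-face.
  Oriented : Fin n → Set
  Oriented d = c d ≡ c3 × c (α d) ≡ c2

  cαα : ∀ d → c (α (α d)) ≡ c d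
  cαα d = cong c (α² d)

  oriented-cases : ∀ {d} → HDart G c c1 d → Oriented d ⊎ Oriented (α d)
  oriented-cases {d} (cd , cαd) with c d in eq | c (α d) in eqα
  ... | c1 | _  = ⊥-elim (cd refl)
  ... | c2 | c1 = ⊥-elim (cαd refl)
  ... | c3 | c1 = ⊥-elim (cαd refl)
  ... | c2 | c2 = ⊥-elim (cα≢ d (trans eqα (sym eq)))
  ... | c3 | c3 = ⊥-elim (cα≢ d (trans eqα (sym eq)))
  ... | c2 | c3 = inj₂ (refl , trans (cαα d) eq)
  ... | c3 | c2 = inj₁ (refl , refl)

  c-third : ∀ {k} d → k ≢ c d → k ≢ c (σ d) → c (σ (σ d)) ≡ k
  c-third d = third-≡ (cσ≢ d ∘ sym) (cσσ≢ d) (cσ≢ (σ d))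

  -- From a separation to the hamiltonian cycle and the A-trail

  module FromSeparation (co : c o ≡ c3) (S : Separation c2 c3) where
    open Separation S

    inC : Fin n → Bool
    inC = δ side

    inC-σ : ∀ d → inC d ≡ side d xor side (σ d)
    inC-σ d = cong (side d xor_) (ϕ-inv-α side-ϕ d)

    two-sided : ∀ d → ¬ (side d ≡ side (σ d) × side (σ d) ≡ side (σ (σ d)))
    two-sided d (p , q) =
      let e , d~e , ce = colour-at-vertex c2 d
          e′ , d~e′ , ce′ = colour-at-vertex c3 d
      in contradiction (trans (sym (side-i ce)) (trans (sym (same d~e)) (trans (same d~e′) (side-j ce′)))) λ ()
      where
      same : ∀ {e} → d ~V e → side d ≡ side e
      same d~e with vertex-cases d~e
      ... | inj₁ refl = refl
      ... | inj₂ (inj₁ refl) = p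
      ... | inj₂ (inj₂ refl) = trans p q

    degree : ∀ d → b2n (inC d) + b2n (inC (σ d)) + b2n (inC (σ (σ d))) ≡ 2
    degree d rewrite inC-σ d | inC-σ (σ d) | inC-σ (σ (σ d)) | σ³ d =
      count (side d) (side (σ d)) (side (σ (σ d))) (two-sided d)
      where
      count : ∀ p q r → ¬ (p ≡ q × q ≡ r) → b2n (p xor q) + b2n (q xor r) + b2n (r xor p) ≡ 2
      count true  true  true  neq = ⊥-elim (neq (refl , refl))
      count true  true  false _ = refl
      count true  false true  _ = refl
      count true  false false _ = refl
      count false true  true  _ = refl
      count false true  false _ = refl
      count false false true  _ = refl
      count false false false neq = ⊥-elim (neq (refl , refl))

    data OnCycle : Fin n → Fin n → Set where
      turn : ∀ d → OnCycle d (σ d)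
      move : ∀ d → inC d ≡ true → OnCycle d (α d)

    CReach : Fin n → Fin n → Set
    CReach = Reach G (λ w → inC w ≡ true) (λ _ → ⊤)

    turn-first : ∀ {u v w} → u ~V v → CReach v w → CReach u w
    turn-first u~v (here v~w) = here (orbit-trans σ u~v v~w)
    turn-first u~v (step x v~x x∈C p rest) = step x (orbit-trans σ u~v v~x) x∈C p rest

    closure⇒reach : ∀ {u v} → EqClosure OnCycle u v → CReach u v
    closure⇒reach ε = here (orbit-refl σ)
    closure⇒reach (fwd (turn d) ◅ rest) = turn-first (orbit-step σ) (closure⇒reach rest)
    closure⇒reach (bwd (turn d) ◅ rest) = turn-first (Vertex.orbit-sym (orbit-step σ)) (closure⇒reach rest)
    closure⇒reach (fwd (move d d∈C) ◅ rest) = step d (orbit-refl σ) d∈C tt (closure⇒reach rest)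
    closure⇒reach {v = v} (bwd (move d d∈C) ◅ rest) =
      step (α d) (orbit-refl σ) (trans (δ-α side d) d∈C) tt
        (subst (λ x → CReach x v) (sym (α² d)) (closure⇒reach rest))

    along-C : Fin n → Fin n
    along-C d = if inC d then α d else d

    along-C-step : ∀ d → EqClosure OnCycle d (along-C d)
    along-C-step d with inC d in d∈C
    ... | true  = return (fwd (move d d∈C))
    ... | false = ε

    C-connected : ∀ u v → CReach u v
    C-connected u v = closure⇒reach (two-maps-connected σ along-C (λ d → return (fwd (turn d))) along-C-step u v
      λ t t-σ t-C → connected t (sym ∘ t-σ)
        (λ d s≢ → sym (trans (t-C d) (cong (λ b → t (if b then α d else d)) (¬-not λ e → s≢ (xor-≡ e))))) u v)

    hamiltonCycle : HamCycle2In3Out G c o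
    hamiltonCycle = inC , (δ-α side , degree , C-connected) , side ,
      (side-ϕ , (λ d → mk⇔ (λ eq → xor-false (sym eq)) (λ eq → sym (xor-≡ eq))) , side-j co) ,
      (λ _ → side-i) , (λ _ → side-j)

    -- At the 1-face reached, C continues along its 3-face if the 1-face is inside C, else along its 2-face.
    ψ : Fin n → Fin n
    ψ d = if side (σ (σ (α d))) then ϕ (ϕ d) else α (ϕ⁻ (ϕ⁻ (α d)))

    corner-ψ : ∀ d → σ (σ (ψ d)) ~F σ (σ (α d))
    corner-ψ d with side (σ (σ (α d)))
    ... | true  = subst (_~F σ (σ (α d))) (sym (σ³ (α (ϕ d)))) (α~σ (ϕ d))
    ... | false = Face.orbit-sym (1 , sym (trans (cong (σ ∘ σ) (α² _)) (σ³ (σ (α (σ (σ (α d))))))))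

    ψ-true : ∀ {d} → side (σ (σ (α d))) ≡ true → ψ d ≡ ϕ (ϕ d)
    ψ-true {d} s = cong (λ b → if b then ϕ (ϕ d) else α (ϕ⁻ (ϕ⁻ (α d)))) s

    ψ-false : ∀ {d} → side (σ (σ (α d))) ≡ false → ψ d ≡ α (ϕ⁻ (ϕ⁻ (α d)))
    ψ-false {d} s = cong (λ b → if b then ϕ (ϕ d) else α (ϕ⁻ (ϕ⁻ (α d)))) s

    -- By `corner-ψ` the side of the 1-face just passed can be read off from the image, so the two
    -- branches, each injective, cannot collide.
    ψ-injective : ∀ {x y} → ψ x ≡ ψ y → x ≡ y
    ψ-injective {x} {y} eq = by-side _ refl
      where
      sides : side (σ (σ (α x))) ≡ side (σ (σ (α y)))
      sides = trans (sym (side~F (corner-ψ x))) (trans (cong (side ∘ σ ∘ σ) eq) (side~F (corner-ψ y)))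
      ϕ⁻-injective : ∀ {a b} → ϕ⁻ a ≡ ϕ⁻ b → a ≡ b
      ϕ⁻-injective p = σ-injective (σ-injective (α-injective p))
      by-side : ∀ b → side (σ (σ (α x))) ≡ b → x ≡ y
      by-side true  s = ϕ-injective (ϕ-injective (trans (sym (ψ-true s)) (trans eq (ψ-true (trans (sym sides) s)))))
      by-side false s = α-injective (ϕ⁻-injective (ϕ⁻-injective (α-injective
        (trans (sym (ψ-false s)) (trans eq (ψ-false (trans (sym sides) s)))))))

    cϕ⁻ : ∀ d → c (ϕ⁻ d) ≡ c d
    cϕ⁻ d = c~F (ϕ⁻-orbit d)

    ψ-oriented : ∀ {d} → Oriented d → Oriented (ψ d)
    ψ-oriented {d} (cd , cαd) = by-side _ refl
      where
      y = ϕ⁻ (ϕ⁻ (α d))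
      ϕϕy : ϕ (ϕ y) ≡ α d
      ϕϕy = trans (cong ϕ (ϕϕ⁻ _)) (ϕϕ⁻ _)
      by-side : ∀ b → side (σ (σ (α d))) ≡ b → Oriented (ψ d)
      by-side true  s = subst Oriented (sym (ψ-true s))
        (trans (cϕ (ϕ d)) (trans (cϕ d) cd) , trans (cαϕϕ d) cαd)
      by-side false s = subst Oriented (sym (ψ-false s))
        (trans (sym (cαϕϕ y)) (trans (cong (c ∘ α) ϕϕy) (trans (cαα d) cd)) ,
         trans (cαα y) (trans (cϕ⁻ _) (trans (cϕ⁻ _) cαd)))

    ψ-same-face : ∀ {d} → Oriented d → ∃[ f ] HFace G c c1 f × EdgeOnFace G c c1 d f × EdgeOnFace G c c1 (ψ d) f
    ψ-same-face {d} (cd , cαd) = by-side _ refl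
      where
      by-side : ∀ b → side (σ (σ (α d))) ≡ b →
                ∃[ f ] HFace G c c1 f × EdgeOnFace G c c1 d f × EdgeOnFace G c c1 (ψ d) f
      by-side true  s = d , (λ p → contradiction (trans (sym cd) p) λ ()) , inj₁ (orbit-refl ϕ) ,
        inj₁ (subst (_~F d) (sym (ψ-true s)) (Face.orbit-sym (2 , refl)))
      by-side false s = α d , (λ p → contradiction (trans (sym cαd) p) λ ()) , inj₂ (orbit-refl ϕ) ,
        inj₂ (subst (_~F α d) (sym (trans (cong α (ψ-false s)) (α² _)))
          (orbit-trans ϕ (ϕ⁻-orbit _) (ϕ⁻-orbit _)))

    module Ψ = OrbitProperties ψ ψ-injective

    one : Fin n → Fin n
    one d = proj₁ (colour-at-vertex c1 d)

    one-≡ : ∀ {d e} → d ~V e → c e ≡ c1 → one d ≡ e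
    one-≡ {d} d~e ce = let f , d~f , cf = colour-at-vertex c1 d in
      ~V-colour-unique (orbit-trans σ (Vertex.orbit-sym d~f) d~e) (trans cf (sym ce))

    orient : Fin n → Fin n
    orient h = if does (c h ≟ᶜ c3) then h else α h

    orient-3 : ∀ {h} → c h ≡ c3 → orient h ≡ h
    orient-3 {h} ch = cong (λ b → if b then h else α h) (dec-true (c h ≟ᶜ c3) ch)

    orient-2 : ∀ {h} → c h ≡ c2 → orient h ≡ α h
    orient-2 {h} ch = cong (λ b → if b then h else α h)
      (dec-false (c h ≟ᶜ c3) λ p → contradiction (trans (sym ch) p) λ ())

    -- The edge between a 2-face and a 3-face at the vertex of d.
    spoke : Fin n → Fin n
    spoke d = orient (σ (one d))

    spoke-≡ : ∀ {d e} → d ~V e → c e ≡ c1 → spoke d ≡ orient (σ e)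
    spoke-≡ d~e ce = cong (orient ∘ σ) (one-≡ d~e ce)

    spoke-oriented : ∀ {d} → Oriented d → spoke d ≡ d × spoke (α d) ≡ d
    spoke-oriented {d} (cd , cαd) =
      trans (spoke-≡ (2 , refl) (c-third d (c1≢ cd c3≢) (c1≢ (trans (sym (cα d)) cαd) c2≢)))
        (trans (cong orient (σ³ d)) (orient-3 cd)) ,
      trans (spoke-≡ (2 , refl) (c-third (α d) (c1≢ cαd c2≢) (c1≢ (trans (cϕ d) cd) c3≢)))
        (trans (cong orient (σ³ (α d))) (trans (orient-2 cαd) (α² d)))
      where
      c1≢ : ∀ {k e} → c e ≡ k → c1 ≢ k → c1 ≢ c e
      c1≢ refl neq = neq
      c2≢ : c1 ≢ c2
      c2≢ ()
      c3≢ : c1 ≢ c3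
      c3≢ ()

    -- An edge of C on a 1-face is passed in one step of `ψ`. For a 3-face across it the 1-face is
    -- inside and the step goes from the end at `α d` to that at `d`; in `spoke-12` the 1-face is
    -- outside and the direction is reversed.
    spoke-13 : ∀ {d} → c d ≡ c1 → c (α d) ≡ c3 → side d ≡ true → ψ (spoke (α d)) ≡ spoke d
    spoke-13 {d} cd cαd s =
      trans (cong ψ (trans (spoke-≡ (orbit-step σ) (trans (cϕ d) cd)) (orient-2 c2-dart)))
        (trans (ψ-true (trans (cong side (trans (cong (σ ∘ σ) (α² _)) (σ³ (ϕ d)))) (trans (side-ϕ d) s)))
          (trans (trans (cong ϕ (trans (cong σ (α² _)) (σ³ (α d)))) (ϕα d))
            (sym (trans (spoke-≡ (orbit-refl σ) cd) (orient-3 (trans (sym (cα d)) cαd))))))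
      where
      c2-dart : c (σ (ϕ d)) ≡ c2
      c2-dart = c-third (α d) (λ p → contradiction (trans p cαd) λ ())
        (λ p → contradiction (trans p (trans (cϕ d) cd)) λ ())

    spoke-12 : ∀ {d} → c d ≡ c1 → c (α d) ≡ c2 → side d ≡ false → ψ (spoke d) ≡ spoke (α d)
    spoke-12 {d} cd cαd s =
      trans (cong ψ (trans (spoke-≡ (orbit-refl σ) cd) (orient-2 (trans (sym (cα d)) cαd))))
        (trans (ψ-false (trans (cong side (trans (cong (σ ∘ σ) (α² _)) (σ³ d))) s))
          (trans (trans (α² _) (trans (cong (λ x → σ (σ (α (σ (σ x))))) (α² _)) (cong (λ x → σ (σ (α x))) (σ³ d))))
            (sym (trans (spoke-≡ (orbit-step σ) (trans (cϕ d) cd)) (orient-3 c3-dart)))))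
      where
      c3-dart : c (σ (ϕ d)) ≡ c3
      c3-dart = c-third (α d) (λ p → contradiction (trans p cαd) λ ())
        (λ p → contradiction (trans p (trans (cϕ d) cd)) λ ())

    module Trail (d₀ : Fin n) (d₀-oriented : Oriented d₀) where

      -- A two-colouring of the vertices by whether the orbit of `d₀` contains their spoke. It is
      -- constant along C, so connectedness of C makes the orbit contain every oriented edge.
      met : Fin n → Bool
      met x = does (Ψ.orbit? d₀ (spoke x))

      met-ψ : ∀ {x y} → ψ (spoke x) ≡ spoke y → met x ≡ met y
      met-ψ {x} {y} eq = does-⇔ (mk⇔ (λ m → orbit-trans ψ m (1 , eq))
        (λ m → orbit-trans ψ m (Ψ.orbit-sym (1 , eq)))) (Ψ.orbit? d₀ (spoke x)) (Ψ.orbit? d₀ (spoke y))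

      met-σ : σ-Invariant met
      met-σ d = cong (λ x → does (Ψ.orbit? d₀ x)) (let e , d~e , ce = colour-at-vertex c1 d in
        trans (spoke-≡ (orbit-trans σ (Vertex.orbit-sym (orbit-step σ)) d~e) ce) (sym (spoke-≡ d~e ce)))

      met-1 : ∀ {d} → c d ≡ c1 → side d ≢ side (α d) → met (α d) ≡ met d
      met-1 {d} cd s≢ = by-colour (c (α d)) refl
        where
        by-colour : ∀ k → c (α d) ≡ k → met (α d) ≡ met d
        by-colour c1 cαd = ⊥-elim (cα≢ d (trans cαd (sym cd)))
        by-colour c2 cαd = sym (met-ψ (spoke-12 cd cαd (¬-not λ s → s≢ (trans s (sym (side-i cαd))))))
        by-colour c3 cαd = met-ψ (spoke-13 cd cαd (¬-not λ s → s≢ (trans s (sym (side-j cαd)))))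

      met-C : ∀ d → side d ≢ side (α d) → met (α d) ≡ met d
      met-C d s≢ = by-colour (c d ≟ᶜ c1) (c (α d) ≟ᶜ c1)
        where
        met-spoke : ∀ {x y z} → spoke x ≡ z × spoke y ≡ z → met y ≡ met x
        met-spoke (p , q) = cong (λ x → does (Ψ.orbit? d₀ x)) (trans q (sym p))
        by-colour : Dec (c d ≡ c1) → Dec (c (α d) ≡ c1) → met (α d) ≡ met d
        by-colour (yes cd) _ = met-1 cd s≢
        by-colour (no _) (yes cαd) = sym (trans (cong met (sym (α² d)))
          (met-1 cαd λ eq → s≢ (sym (trans eq (cong side (α² d))))))
        by-colour (no cd) (no cαd) with oriented-cases (cd , cαd)
        ... | inj₁ or = met-spoke (spoke-oriented or)
        ... | inj₂ or = sym (trans (cong met (sym (α² d))) (met-spoke (spoke-oriented or)))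

      reached : ∀ {d} → Oriented d → Orbit ψ d₀ d
      reached {d} or = subst (Orbit ψ d₀) (proj₁ (spoke-oriented or))
        (does-true (Ψ.orbit? d₀ (spoke d)) (trans (connected met met-σ met-C d d₀)
          (dec-true (Ψ.orbit? d₀ (spoke d₀)) (0 , sym (proj₁ (spoke-oriented d₀-oriented))))))

      Returns : Fin n → Set
      Returns k = iter ψ (suc (toℕ k)) d₀ ≡ d₀

      first-return : ∃ λ k → Returns k × (∀ l → Returns l → toℕ k ≤ toℕ l)
      first-return = let p , p<n , eq = Ψ.period d₀ in
        least (λ k → iter ψ (suc (toℕ k)) d₀ ≟ d₀)
          (fromℕ< p<n , trans (cong (λ m → iter ψ (suc m) d₀) (toℕ-fromℕ< p<n)) eq)

      module Closed (k : Fin n) (returns : Returns k) (minimal : ∀ l → Returns l → toℕ k ≤ toℕ l) where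

        t : Fin (suc (toℕ k)) → Fin n
        t l = iter ψ (toℕ l) d₀

        t-next : ∀ l → t (next l) ≡ ψ (t l)
        t-next l with view l
        ... | ‵fromℕ = trans (cong t (next-fromℕ (toℕ k)))
          (trans (sym returns) (cong (λ m → ψ (iter ψ m d₀)) (sym (toℕ-fromℕ (toℕ k)))))
        ... | ‵inject₁ l′ = trans (cong t (next-inject₁ l′)) (cong (λ m → ψ (iter ψ m d₀)) (sym (toℕ-inject₁ l′)))

        t-oriented : ∀ l → Oriented (t l)
        t-oriented l = go (toℕ l)
          where
          go : ∀ m → Oriented (iter ψ m d₀)
          go zero = d₀-oriented
          go (suc m) = ψ-oriented (go m)

        t-covers : ∀ {d} → Orbit ψ d₀ d → ∃[ l ] t l ≡ d
        t-covers (m , refl) = go m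
          where
          go : ∀ m → ∃[ l ] t l ≡ iter ψ m d₀
          go zero = zero , refl
          go (suc m) = let l , eq = go m in next l , trans (t-next l) (cong ψ eq)

        -- Injectivity of `ψ` cancels a repetition down to a return to `d₀` before the first one.
        no-early-return : ∀ (l l′ : Fin (suc (toℕ k))) → toℕ l < toℕ l′ → t l ≢ t l′
        no-early-return l l′ lt eq = ℕ.<⇒≱ q<k (subst (toℕ k ≤_) (toℕ-fromℕ< q<n)
          (minimal (fromℕ< q<n) (trans (cong (λ m → iter ψ (suc m) d₀) (toℕ-fromℕ< q<n)) loop)))
          where
          q = toℕ l′ ∸ suc (toℕ l)
          q<k : q < toℕ k
          q<k = ℕ.<-≤-trans (ℕ.∸-monoʳ-< (ℕ.n<1+n (toℕ l)) lt) (ℕ.≤-trans (ℕ.m∸n≤m (toℕ l′) (toℕ l)) (ℕ.≤-pred (toℕ<n l′)))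
          q<n : q < n
          q<n = ℕ.<-trans q<k (toℕ<n k)
          l′-split : toℕ l + suc q ≡ toℕ l′
          l′-split = trans (ℕ.+-suc (toℕ l) q) (ℕ.m+[n∸m]≡n lt)
          loop : iter ψ (suc q) d₀ ≡ d₀
          loop = iter-injective ψ ψ-injective (toℕ l) (trans (sym (iter-+ ψ (toℕ l) (suc q) d₀))
            (trans (cong (λ m → iter ψ m d₀) l′-split) (sym eq)))

        t-injective : ∀ l l′ → t l ≡ t l′ → l ≡ l′
        t-injective l l′ eq with ℕ.<-cmp (toℕ l) (toℕ l′)
        ... | tri< lt _ _ = ⊥-elim (no-early-return l l′ lt eq)
        ... | tri≈ _ p _  = toℕ-injective p
        ... | tri> _ _ gt = ⊥-elim (no-early-return l′ l gt (sym eq))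

        trail : HasATrail G c c1
        trail = toℕ k , t , hdart , consecutive , covers , once ,
          (λ l → let f , hf , on , onψ = ψ-same-face (t-oriented l) in
            f , hf , on , subst (λ x → EdgeOnFace G c c1 x f) (sym (t-next l)) onψ)
          where
          hdart : ∀ l → HDart G c c1 (t l)
          hdart l = let cd , cαd = t-oriented l in
            (λ p → contradiction (trans (sym cd) p) λ ()) , (λ p → contradiction (trans (sym cαd) p) λ ())
          corner-1 : ∀ l → c (σ (σ (α (t l)))) ≡ c1
          corner-1 l = let cd , cαd = t-oriented l in c-third (α (t l))
            (λ p → contradiction (trans p cαd) λ ()) (λ p → contradiction (trans p (trans (cϕ (t l)) cd)) λ ())
          consecutive : ∀ l → SameHV G c c1 (α (t l)) (t (next l))
          consecutive l = σ (σ (α (t l))) , corner-1 l , (σ (σ (α (t l))) , (2 , refl) , orbit-refl ϕ) ,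
            subst (λ x → AtV G c c1 x (σ (σ (α (t l))))) (sym (t-next l)) (σ (σ (ψ (t l))) , (2 , refl) , corner-ψ (t l))
          covers : ∀ d → HDart G c c1 d → ∃[ l ] (t l ≡ d ⊎ t l ≡ α d)
          covers d hd with oriented-cases hd
          ... | inj₁ or = let l , eq = t-covers (reached or) in l , inj₁ eq
          ... | inj₂ or = let l , eq = t-covers (reached or) in l , inj₂ eq
          once : ∀ l l′ → t l ≡ t l′ ⊎ t l ≡ α (t l′) → l ≡ l′
          once l l′ (inj₁ eq) = t-injective l l′ eq
          once l l′ (inj₂ eq) = contradiction (trans (sym (proj₁ (t-oriented l))) (trans (cong c eq) (proj₂ (t-oriented l′)))) λ ()

    aTrail : HasATrail G c c1
    aTrail = let d₀ , or = start (oriented-cases hd) ; k , returns , minimal = Trail.first-return d₀ or in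
      Trail.Closed.trail d₀ or k returns minimal
      where
      h = σ (one o)
      hd : HDart G c c1 h
      hd = (λ p → cσ≢ (one o) (trans p (sym c-one))) , (λ p → cσσ≢ (one o) (trans (sym (cα h)) (trans p (sym c-one))))
        where c-one = proj₂ (proj₂ (colour-at-vertex c1 o))
      start : Oriented h ⊎ Oriented (α h) → ∃ Oriented
      start (inj₁ or) = h , or
      start (inj₂ or) = α h , or

  -- Consecutive edges of an A-trail follow each other around their common vertex, so the trail pairs off
  -- the edges around every 1-face, alternately along 2-faces and along 3-faces.
  module FromATrail {k : ℕ} (t : Fin (suc k) → Fin n) (hdart : ∀ l → HDart G c c1 (t l))
    (consecutive : ∀ l → SameHV G c c1 (α (t l)) (t (next l)))
    (covers : ∀ d → HDart G c c1 d → ∃[ l ] (t l ≡ d ⊎ t l ≡ α d))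
    (once : ∀ l l′ → t l ≡ t l′ ⊎ t l ≡ α (t l′) → l ≡ l′)
    (common-face : ∀ l → ∃[ f ] HFace G c c1 f × EdgeOnFace G c c1 (t l) f × EdgeOnFace G c c1 (t (next l)) f)
    where

    -- Both darts point away from the reduced vertex: `α (t l)` is the edge by which the trail
    -- arrives, `t (next l)` the one by which it leaves. The relation forgets this direction.
    Partner : Fin n → Fin n → Set
    Partner e y = ∃[ l ] ((α (t l) ≡ e × t (next l) ≡ y) ⊎ (α (t l) ≡ y × t (next l) ≡ e))

    partner? : ∀ e y → Dec (Partner e y)
    partner? e y = any? λ l → ((α (t l) ≟ e) ×-dec (t (next l) ≟ y)) ⊎-dec ((α (t l) ≟ y) ×-dec (t (next l) ≟ e))

    partner-sym : ∀ {e y} → Partner e y → Partner y e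
    partner-sym (l , inj₁ p) = l , inj₂ p
    partner-sym (l , inj₂ p) = l , inj₁ p

    not-both : ∀ l l′ → α (t l) ≢ t l′
    not-both l l′ eq = α≢ (t l) (trans eq (cong t (once l′ l (inj₂ (sym eq)))))

    partner-unique : ∀ {e y y′} → Partner e y → Partner e y′ → y ≡ y′
    partner-unique (l , inj₁ (p , q)) (l′ , inj₁ (p′ , q′)) =
      trans (sym q) (trans (cong (t ∘ next) (once l l′ (inj₁ (α-injective (trans p (sym p′)))))) q′)
    partner-unique (l , inj₁ (p , q)) (l′ , inj₂ (p′ , q′)) = ⊥-elim (not-both l (next l′) (trans p (sym q′)))
    partner-unique (l , inj₂ (p , q)) (l′ , inj₁ (p′ , q′)) = ⊥-elim (not-both l′ (next l) (trans p′ (sym q)))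
    partner-unique (l , inj₂ (p , q)) (l′ , inj₂ (p′ , q′)) =
      trans (sym p) (trans (cong (α ∘ t) (trans (sym (prev-next l))
        (trans (cong prev (once (next l) (next l′) (inj₁ (trans q (sym q′))))) (prev-next l′)))) p′)

    hdart-corner : ∀ {d} → HDart G c c1 d → c (σ (σ d)) ≡ c1
    hdart-corner {d} (cd , cαd) = c-third d (cd ∘ sym) (λ p → cαd (trans (cα d) (sym p)))

    hdart-α : ∀ {d} → HDart G c c1 d → HDart G c c1 (α d)
    hdart-α {d} (cd , cαd) = cαd , λ p → cd (trans (sym (cαα d)) p)

    ασ~ : ∀ d → α (σ d) ~F σ (σ d)
    ασ~ d = α~σ (σ d)

    ασσ~ : ∀ d → α (σ (σ d)) ~F d
    ασσ~ = ϕ⁻-orbit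

    -- Each face along `e` shares with the 1-face at `e` only the edge beside `e`, by
    -- `unique-common-edge`. A common face of `e` and `y` thus puts `y` at the other end of one of
    -- these two edges.
    neighbouring : ∀ {e y} → e ≢ y → σ (σ e) ~F σ (σ y) →
      (e ~F y ⊎ α e ~F α y) ⊎ (e ~F α y ⊎ α e ~F y) → y ≡ σ (σ (α (σ (σ e)))) ⊎ y ≡ σ (α (σ e))
    neighbouring {e} {y} e≢y corner (inj₁ (inj₁ e~y)) = ⊥-elim (e≢y (σ-injective (σ-injective
      (unique-common-edge corner (orbit-trans ϕ (ασσ~ e) (orbit-trans ϕ e~y (Face.orbit-sym (ασσ~ y))))))))
    neighbouring {e} {y} e≢y corner (inj₁ (inj₂ αe~αy)) = ⊥-elim (e≢y (σ-injective (unique-common-edge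
      (orbit-trans ϕ (Face.orbit-sym (α~σ e)) (orbit-trans ϕ αe~αy (α~σ y)))
      (orbit-trans ϕ (ασ~ e) (orbit-trans ϕ corner (Face.orbit-sym (ασ~ y)))))))
    neighbouring {e} {y} e≢y corner (inj₂ (inj₁ e~αy)) = inj₁ (trans (sym (σ³ y)) (cong (σ ∘ σ) (sym
      (unique-common-edge (orbit-trans ϕ (ασσ~ e) (orbit-trans ϕ e~αy (α~σ y)))
        (subst (_~F α (σ y)) (sym (α² _)) (orbit-trans ϕ corner (Face.orbit-sym (ασ~ y))))))))
    neighbouring {e} {y} e≢y corner (inj₂ (inj₂ αe~y)) = inj₂ (trans (sym (σ³ y)) (cong σ (trans (sym (α² _)) (cong α (sym
      (unique-common-edge (orbit-trans ϕ (Face.orbit-sym (α~σ e)) (orbit-trans ϕ αe~y (Face.orbit-sym (ασσ~ y))))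
        (subst (α (σ e) ~F_) (sym (α² _)) (orbit-trans ϕ (ασ~ e) corner))))))))

    turns : ∀ l → let e = α (t l) ; y = t (next l) in y ≡ σ (σ (α (σ (σ e)))) ⊎ y ≡ σ (α (σ e))
    turns l = neighbouring (not-both l (next l)) corner (faces (common-face l))
      where
      e = α (t l)
      y = t (next l)
      at-corner : ∀ {d X} → HDart G c c1 d → c X ≡ c1 → AtV G c c1 d X → σ (σ d) ~F X
      at-corner hd cX (f , d~f , f~X) = subst (_~F _) (sym (~V-colour-unique
        (orbit-trans σ (Vertex.orbit-sym (2 , refl)) d~f) (trans (hdart-corner hd) (sym (trans (c~F f~X) cX))))) f~X
      corner : σ (σ e) ~F σ (σ y)
      corner = let X , cX , e-X , y-X = consecutive l in orbit-trans ϕ (at-corner (hdart-α (hdart l)) cX e-X)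
        (Face.orbit-sym (at-corner (hdart (next l)) cX y-X))
      faces : (∃[ f ] HFace G c c1 f × EdgeOnFace G c c1 (t l) f × EdgeOnFace G c c1 y f) →
              (e ~F y ⊎ α e ~F α y) ⊎ (e ~F α y ⊎ α e ~F y)
      faces (f , _ , inj₁ p , inj₁ q) = inj₂ (inj₂ (subst (_~F y) (sym (α² _)) (orbit-trans ϕ p (Face.orbit-sym q))))
      faces (f , _ , inj₁ p , inj₂ q) = inj₁ (inj₂ (subst (_~F α y) (sym (α² _)) (orbit-trans ϕ p (Face.orbit-sym q))))
      faces (f , _ , inj₂ p , inj₁ q) = inj₁ (inj₁ (orbit-trans ϕ p (Face.orbit-sym q)))
      faces (f , _ , inj₂ p , inj₂ q) = inj₂ (inj₁ (orbit-trans ϕ p (Face.orbit-sym q)))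

    hdart-beside : ∀ {x} → c x ≡ c1 → HDart G c c1 (σ x)
    hdart-beside {x} cx = (λ p → cσ≢ x (trans p (sym cx))) , (λ p → cσσ≢ x (trans (sym (cα (σ x))) (trans p (sym cx))))

    partner : ∀ {x} → c x ≡ c1 → ∃[ y ] Partner (σ x) y × (y ≡ σ (σ (α x)) ⊎ y ≡ σ (α (σ (σ x))))
    partner {x} cx = go (covers (σ x) (hdart-beside cx))
      where
      go : ∃[ l ] (t l ≡ σ x ⊎ t l ≡ α (σ x)) →
           ∃[ y ] Partner (σ x) y × (y ≡ σ (σ (α x)) ⊎ y ≡ σ (α (σ (σ x))))
      go (l , inj₂ eq) = t (next l) , (l , inj₁ (αt , refl)) ,
        [ (λ p → inj₁ (trans p (trans (cong (λ e → σ (σ (α (σ (σ e))))) αt) (cong (λ e → σ (σ (α e))) (σ³ x)))))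
        , (λ p → inj₂ (trans p (cong (λ e → σ (α (σ e))) αt))) ]′ (turns l)
        where
        αt : α (t l) ≡ σ x
        αt = trans (cong α eq) (α² (σ x))
      go (l , inj₁ eq) = e , (prev l , inj₂ (refl , y≡)) ,
        [ (λ p → inj₂ (back₁ (trans (sym y≡) p))) , (λ p → inj₁ (back₂ (trans (sym y≡) p))) ]′ (turns (prev l))
        where
        e = α (t (prev l))
        y≡ : t (next (prev l)) ≡ σ x
        y≡ = trans (cong t (next-prev l)) eq
        back₁ : σ x ≡ σ (σ (α (σ (σ e)))) → e ≡ σ (α (σ (σ x)))
        back₁ p = sym (trans (cong (λ z → σ (α (σ z))) p) (trans (cong (σ ∘ α) (σ³ _)) (trans (cong σ (α² _)) (σ³ e))))
        back₂ : σ x ≡ σ (α (σ e)) → e ≡ σ (σ (α x))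
        back₂ p = sym (trans (cong (λ z → σ (σ (α z))) (σ-injective p)) (trans (cong (σ ∘ σ) (α² (σ e))) (σ³ e)))

    -- Whether the trail passes alongside the edge of x at the 1-face of x.
    used : Fin n → Bool
    used x = does (partner? (σ x) (σ (σ (α x))))

    -- The dart `σ (ϕ x)` at the vertex between the edges of `x` and `ϕ x` has a single partner,
    -- which lies along exactly one of them; a partner along both would yield parallel edges.
    used-ϕ : ∀ {x} → c x ≡ c1 → used (ϕ x) ≡ not (used x)
    used-ϕ {x} cx = does-⇔ (mk⇔ to from) (partner? (σ (ϕ x)) (σ (σ (α (ϕ x))))) (¬? (partner? (σ x) (σ (σ (α x)))))
      where
      to : Partner (σ (ϕ x)) (σ (σ (α (ϕ x)))) → ¬ Partner (σ x) (σ (σ (α x)))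
      to p q = σ≢ (α x) (no-parallel (Vertex.orbit-sym (orbit-step σ))
        (subst (α (ϕ x) ~V_) (sym (α² x)) (orbit-trans σ (2 , partner-unique p (partner-sym q))
          (Vertex.orbit-sym (orbit-step σ)))))
      from : ¬ Partner (σ x) (σ (σ (α x))) → Partner (σ (ϕ x)) (σ (σ (α (ϕ x))))
      from ¬q = go (partner (trans (cϕ x) cx))
        where
        go : ∃[ y ] Partner (σ (ϕ x)) y × (y ≡ σ (σ (α (ϕ x))) ⊎ y ≡ σ (α (σ (σ (ϕ x))))) →
             Partner (σ (ϕ x)) (σ (σ (α (ϕ x))))
        go (y , p , inj₁ refl) = p
        go (y , p , inj₂ refl) = ⊥-elim (¬q (partner-sym (subst (Partner (σ (ϕ x)))
          (trans (cong (σ ∘ α) (σ³ (α x))) (cong σ (α² x))) p)))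

    is3 : Color → Bool
    is3 k = does (k ≟ᶜ c3)

    sideOf : Color → Bool → Bool
    sideOf c1 b = b
    sideOf c2 _ = true
    sideOf c3 _ = false

    -- A 1-face is inside C if the trail passes alongside its edges with 3-faces.
    side : Fin n → Bool
    side d = sideOf (c d) (not (used d xor is3 (c (α d))))

    is3-flip : ∀ {a b} → a ≢ c1 → b ≢ c1 → a ≢ b → is3 a ≡ not (is3 b)
    is3-flip {c1} a≢ _ _ = ⊥-elim (a≢ refl)
    is3-flip {_} {c1} _ b≢ _ = ⊥-elim (b≢ refl)
    is3-flip {c2} {c2} _ _ a≢b = ⊥-elim (a≢b refl)
    is3-flip {c3} {c3} _ _ a≢b = ⊥-elim (a≢b refl)
    is3-flip {c2} {c3} _ _ _ = refl
    is3-flip {c3} {c2} _ _ _ = refl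

    -- Along a 1-face both `used` and the colour across the edge alternate, so their `xor` does not
    -- change.
    side-ϕ : ϕ-Invariant side
    side-ϕ d = trans (cong (λ k → sideOf k (not (used (ϕ d) xor is3 (c (α (ϕ d)))))) (cϕ d)) (by-colour (c d) refl)
      where
      by-colour : ∀ k → c d ≡ k → sideOf k (not (used (ϕ d) xor is3 (c (α (ϕ d))))) ≡
                                  side d
      by-colour c1 cd = trans (cong not (trans (cong₂ _xor_ (used-ϕ cd) (is3-flip
          (λ p → cα≢ (ϕ d) (trans p (sym (trans (cϕ d) cd)))) (λ p → cα≢ d (trans p (sym cd)))
          (λ p → cσσ≢ (α d) (trans (sym (cα (ϕ d))) p))))
          (xor-annihilates-not (used d) (is3 (c (α d))))))
        (cong (λ k → sideOf k (not (used d xor is3 (c (α d))))) (sym cd))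
      by-colour c2 cd = cong (λ k → sideOf k (not (used d xor is3 (c (α d))))) (sym cd)
      by-colour c3 cd = cong (λ k → sideOf k (not (used d xor is3 (c (α d))))) (sym cd)

    side-2 : ∀ {d} → c d ≡ c2 → side d ≡ true
    side-2 {d} cd = cong (λ k → sideOf k (not (used d xor is3 (c (α d))))) cd

    side-3 : ∀ {d} → c d ≡ c3 → side d ≡ false
    side-3 {d} cd = cong (λ k → sideOf k (not (used d xor is3 (c (α d))))) cd

    side-1 : ∀ {d} → c d ≡ c1 → used d ≡ true → side d ≡ is3 (c (α d))
    side-1 {d} cd u = trans (cong₂ (λ k b → sideOf k (not (b xor is3 (c (α d))))) cd u) (not-involutive _)

    -- Edges that the trail passes alongside are on C; the side of a 1-face is chosen for this.
    crosses-used : ∀ {x} → c x ≡ c1 → used x ≡ true → side x ≢ side (α x)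
    crosses-used {x} cx u = by-colour (c (α x)) refl
      where
      by-colour : ∀ k → c (α x) ≡ k → side x ≢ side (α x)
      by-colour c1 cαx = ⊥-elim (cα≢ x (trans cαx (sym cx)))
      by-colour c2 cαx eq = contradiction (trans (sym (trans (side-1 cx u) (cong is3 cαx))) (trans eq (side-2 cαx))) λ ()
      by-colour c3 cαx eq = contradiction (trans (sym (trans (side-1 cx u) (cong is3 cαx))) (trans eq (side-3 cαx))) λ ()

    crosses-hdart : ∀ {d} → HDart G c c1 d → side d ≢ side (α d)
    crosses-hdart {d} hd eq with oriented-cases hd
    ... | inj₁ (cd , cαd) = contradiction (trans (sym (side-3 cd)) (trans eq (side-2 cαd))) λ ()
    ... | inj₂ (cαd , cααd) =
      contradiction (trans (sym (side-3 cαd)) (trans (sym eq) (side-2 (trans (sym (cαα d)) cααd)))) λ ()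

    module Connected (τ : Fin n → Bool) (τ-inv : σ-Invariant τ)
                     (τ-C : ∀ d → side d ≢ side (α d) → τ (α d) ≡ τ d) where

      τ-used : ∀ {x} → c x ≡ c1 → Partner (σ x) (σ (σ (α x))) → τ (σ (σ (α x))) ≡ τ (σ x)
      τ-used {x} cx p = trans (trans (τ-inv _) (τ-inv _)) (trans
        (τ-C x (crosses-used cx (dec-true (partner? (σ x) (σ (σ (α x)))) p))) (sym (τ-inv x)))

      -- The turn runs alongside an edge of the 1-face, that of `σ (σ e)` or of `α (σ e)`, which is
      -- used and therefore on C.
      τ-turn : ∀ l → τ (t (next l)) ≡ τ (α (t l))
      τ-turn l = go (turns l)
        where
        e = α (t l)
        y = t (next l)
        go : y ≡ σ (σ (α (σ (σ e)))) ⊎ y ≡ σ (α (σ e)) → τ y ≡ τ e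
        go (inj₁ p) = trans (cong τ p) (trans (τ-used (hdart-corner (hdart-α (hdart l)))
          (subst₂ Partner (sym (σ³ e)) p (l , inj₁ (refl , refl)))) (cong τ (σ³ e)))
        go (inj₂ p) = trans (cong τ p) (trans (sym (τ-used
          (trans (sym (cϕ (α (σ e)))) (trans (cong c (ϕα (σ e))) (hdart-corner (hdart-α (hdart l)))))
          (subst₂ Partner p (sym e≡) (l , inj₂ (refl , refl))))) (cong τ e≡))
          where
          e≡ : σ (σ (α (α (σ e)))) ≡ e
          e≡ = trans (cong (σ ∘ σ) (α² (σ e))) (σ³ e)

      τ-next : ∀ l → τ (t (next l)) ≡ τ (t l)
      τ-next l = trans (τ-turn l) (τ-C (t l) (crosses-hdart (hdart l)))

      τ-trail : ∀ l → τ (t l) ≡ τ (t zero)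
      τ-trail = <-weakInduction (λ l → τ (t l) ≡ τ (t zero)) refl
        λ l eq → trans (cong (τ ∘ t) (sym (next-inject₁ l))) (trans (τ-next (inject₁ l)) eq)

      τ-start : ∀ x → τ x ≡ τ (t zero)
      τ-start x = let e , x~e , ce = colour-at-vertex c1 x in
        trans (invariant-orbit σ τ τ-inv x~e) (trans (sym (τ-inv e)) (go (covers (σ e) (hdart-beside ce))))
        where
        go : ∀ {d} → ∃[ l ] (t l ≡ d ⊎ t l ≡ α d) → τ d ≡ τ (t zero)
        go (l , inj₁ refl) = τ-trail l
        go {d} (l , inj₂ eq) = trans (cong τ (trans (sym (α² d)) (cong α (sym eq))))
          (trans (τ-C (t l) (crosses-hdart (hdart l))) (τ-trail l))

    separation : Separation c2 c3
    separation = record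
      { side = side ; side-ϕ = side-ϕ ; side-i = side-2 ; side-j = side-3
      ; connected = λ τ τ-inv τ-C x y → let open Connected τ τ-inv τ-C in trans (τ-start x) (sym (τ-start y)) }

  aTrail⇒separation : HasATrail G c c1 → Separation c2 c3
  aTrail⇒separation (k , t , hdart , consecutive , covers , once , common-face) =
    FromATrail.separation t hdart consecutive covers once common-face

theorem2 : (G : Map) (c : Fin (Map.n G) → Color) (o : Fin (Map.n G)) →
    Barnette G → FaceColoring G c → c o ≡ c3 →
    (HamCycle2In3Out G c o ⇔ HasATrail G c c1)
    × (HasATrail G c c1 ⇔ HasSpanningTreeOf1Faces G c c2 o)
    × (HasSpanningTreeOf1Faces G c c2 o ⇔ HasSpanningTreeOf1Faces G c c3 o)
theorem2 G c o barnette colouring co =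
  mk⇔ (FromSeparation.aTrail co ∘ hamiltonCycle⇒separation) (FromSeparation.hamiltonCycle co ∘ aTrail⇒separation) ,
  mk⇔ (separation⇒tree₂ ∘ aTrail⇒separation) (FromSeparation.aTrail co ∘ tree₂⇒separation) ,
  mk⇔ (separation⇒tree₃ ∘ tree₂⇒separation) (separation⇒tree₂ ∘ tree₃⇒separation)
  where
  open Equivalences G c o barnette colouring
  module Tree₂ = SpanningTree {c2} {c3} (λ ()) (λ ()) (λ ())
  module Tree₃ = SpanningTree {c3} {c2} (λ ()) (λ ()) (λ ())
  co≢c1 : c o ≢ c1
  co≢c1 eq = contradiction (trans (sym co) eq) λ ()
  separation⇒tree₂ : Separation c2 c3 → HasSpanningTreeOf1Faces G c c2 o
  separation⇒tree₂ S = Tree₂.SeparationToTree.spanningTree S co≢c1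
  tree₂⇒separation : HasSpanningTreeOf1Faces G c c2 o → Separation c2 c3
  tree₂⇒separation (inT , spanning) = Tree₂.TreeToSeparation.separation inT spanning
  separation⇒tree₃ : Separation c2 c3 → HasSpanningTreeOf1Faces G c c3 o
  separation⇒tree₃ S = Tree₃.SeparationToTree.spanningTree (opposite S) co≢c1
  tree₃⇒separation : HasSpanningTreeOf1Faces G c c3 o → Separation c2 c3
  tree₃⇒separation (inT , spanning) = opposite (Tree₃.TreeToSeparation.separation inT spanning)
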